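{- Let $G$ be a finite graph with no isolated vertices and with maximum degree at most two. Then $\sigma(G)=\delta(G)$, except for the two graphs $G=C_4$ and $G=C_4+P_2$, for which $\sigma(G)=\delta(G)+1$.
   Context: All graphs are finite, simple and undirected. A graph $H=(V,E)$ is a sum graph if there is an injective map $\lambda:V\to\mathbb{N}=\{1,2,\dots\}$ (a sum labelling) such that $E=\{xy : \exists z\in V,\ \lambda(z)=\lambda(x)+\lambda(y)\}$. For a graph $G$ without isolated vertices, the sum number $\sigma(G)$ is the minimum $k\ge 0$ such that $G+N_k$ is a sum graph, where $N_k$ is the edgeless graph on $k$ vertices and $+$ denotes disjoint union. $\delta(G)$ is the minimum degree of $G$; $C_n$ is the cycle on $n$ vertices and $P_k$ is the path on $k$ vertices. -}

module Defs where

open import Data.Bool using (Bool; true; false; _∨_)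
open import Data.Nat using (ℕ; zero; suc; _+_; _≤_; ∣_-_∣; _≡ᵇ_)
open import Data.Nat.Properties using (∣-∣-comm; ∣n-n∣≡0)
open import Data.Fin using (Fin; toℕ; splitAt)
open import Data.Fin.Subset using (∣_∣)
open import Data.Vec using (tabulate)
open import Data.Sum using (_⊎_; inj₁; inj₂)
open import Data.Product using (Σ; ∃; _×_)
open import Function.Bundles using (_↔_; Inverse; _⇔_)
open import Function.Definitions using (Injective)
open import Relation.Binary.PropositionalEquality using (_≡_; _≢_; refl; cong)

record Graph (n : ℕ) : Set where
  field
    adj    : Fin n → Fin n → Bool
    sym    : ∀ i j → adj i j ≡ adj j i
    irrefl : ∀ i → adj i i ≡ false
open Graph public

deg : ∀ {n} → Graph n → Fin n → ℕ
deg G v = ∣ tabulate (adj G v) ∣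

IsMinDegree : ∀ {n} → Graph n → ℕ → Set
IsMinDegree G d = (∃ λ v → deg G v ≡ d) × (∀ v → d ≤ deg G v)

NoIsolated : ∀ {n} → Graph n → Set
NoIsolated G = ∀ v → 1 ≤ deg G v

MaxDegAtMost : ∀ {n} → Graph n → ℕ → Set
MaxDegAtMost G k = ∀ v → deg G v ≤ k

private
  ⊕adj : ∀ {n m} → Graph n → Graph m → Fin (n + m) → Fin (n + m) → Bool
  ⊕adj {n} G H i j with splitAt n i | splitAt n j
  ... | inj₁ a | inj₁ b = adj G a b
  ... | inj₂ a | inj₂ b = adj H a b
  ... | inj₁ _ | inj₂ _ = false
  ... | inj₂ _ | inj₁ _ = false

  ⊕sym : ∀ {n m} (G : Graph n) (H : Graph m) i j → ⊕adj G H i j ≡ ⊕adj G H j i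
  ⊕sym {n} G H i j with splitAt n i | splitAt n j
  ... | inj₁ a | inj₁ b = sym G a b
  ... | inj₂ a | inj₂ b = sym H a b
  ... | inj₁ _ | inj₂ _ = refl
  ... | inj₂ _ | inj₁ _ = refl

  ⊕irr : ∀ {n m} (G : Graph n) (H : Graph m) i → ⊕adj G H i i ≡ false
  ⊕irr {n} G H i with splitAt n i
  ... | inj₁ a = irrefl G a
  ... | inj₂ a = irrefl H a

infixl 6 _⊕_
_⊕_ : ∀ {n m} → Graph n → Graph m → Graph (n + m)
G ⊕ H = record { adj = ⊕adj G H ; sym = ⊕sym G H ; irrefl = ⊕irr G H }

N : (k : ℕ) → Graph k
N k = record { adj = λ _ _ → false ; sym = λ _ _ → refl ; irrefl = λ _ → refl }

distGraph : (n : ℕ) (p : ℕ → Bool) → p 0 ≡ false → Graph n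
distGraph n p p0 = record
  { adj    = λ i j → p ∣ toℕ i - toℕ j ∣
  ; sym    = λ i j → cong p (∣-∣-comm (toℕ i) (toℕ j))
  ; irrefl = λ i → Relation.Binary.PropositionalEquality.trans (cong p (∣n-n∣≡0 (toℕ i))) p0
  }
  where import Relation.Binary.PropositionalEquality

C4 : Graph 4
C4 = distGraph 4 (λ d → (d ≡ᵇ 1) ∨ (d ≡ᵇ 3)) refl

P2 : Graph 2
P2 = distGraph 2 (λ d → d ≡ᵇ 1) refl

_≅_ : ∀ {n m} → Graph n → Graph m → Set
_≅_ {n} {m} G H = Σ (Fin n ↔ Fin m) λ f →
  ∀ i j → adj H (Inverse.to f i) (Inverse.to f j) ≡ adj G i j

IsSumLabelling : ∀ {n} → Graph n → (Fin n → ℕ) → Set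
IsSumLabelling {n} H ℓ =
  Injective _≡_ _≡_ ℓ × (∀ v → 1 ≤ ℓ v) ×
  (∀ x y → x ≢ y → (adj H x y ≡ true ⇔ (∃ λ (z : Fin n) → ℓ z ≡ ℓ x + ℓ y)))

IsSumGraph : ∀ {n} → Graph n → Set
IsSumGraph {n} H = ∃ λ (ℓ : Fin n → ℕ) → IsSumLabelling H ℓ

IsSumNumber : ∀ {n} → Graph n → ℕ → Set
IsSumNumber G s = IsSumGraph (G ⊕ N s) × (∀ k → IsSumGraph (G ⊕ N k) → s ≤ k)

{-# OPTIONS --safe #-}

-- Adding the vertices one at a time decomposes G into paths and cycles, because a vertex of degree at most
-- one is always an end of a path.
--
-- Upper bound. The labels of consecutive vertices of a component form a Fibonacci-like sequence, each edge sum
-- being the next label. A path leaves one isolate; closing a cycle y₁, …, yₙ adds the isolate y₁ + yₙ, which is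
-- harmless unless n = 4. The isolates of one component, larger than all other labels, start the next one. Two
-- copies of C₄ are appended together after doubling the old labels, and a single C₄ is combined at the start
-- with another cycle, with a path on at least three vertices, with two copies of P₂ or with two further C₄.
--
-- Lower bound. The edge sums at the vertex of G with the largest label are labels of isolates. In a C₄ with
-- vertices a, b, c, d in cyclic order, a largest and b < d, the sums c + b < a + b < a + d are labels of
-- vertices outside C₄: this needs three isolates for C₄ and two for C₄ + P₂.
module Submission where

open import Defs renaming (sym to adj-sym)
open import Data.Bool using (true; false)
import Data.Bool.Properties as Bool
open import Data.Empty using (⊥; ⊥-elim)
open import Data.Fin using (Fin; zero; suc; splitAt; join)
open import Data.Fin.Patterns
import Data.Fin.Properties as Fin
open import Data.Fin.Subset using (⁅_⁆; ∣_∣) renaming (_∈_ to _∈ₛ_)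
open import Data.Fin.Subset.Properties
  using (nonempty?; Empty-unique; ∣⊥∣≡0; ∣⁅x⁆∣≡1; p⊆q⇒∣p∣≤∣q∣; x∈⁅x⁆; x∈p⇒∣p-x∣<∣p∣; x∈p∧x≢y⇒x∈p-y)
open import Data.List using (List; []; _∷_; _++_; _ʳ++_; map; concatMap; length; replicate; lookup)
open import Data.List.Properties
  using (++-ʳ++; map-++; length-map; map-∘; map-cong; ∷-injective) renaming (++-assoc to ++-assoc-≡)
open import Data.List.Membership.Propositional using (_∈_; _∉_)
open import Data.List.Membership.Propositional.Properties
  using (∈-++⁺ˡ; ∈-++⁺ʳ; ∈-++⁻; ∈-map⁺; ∈-map⁻; ∈-lookup; ∈-∃++)
import Data.List.Membership.DecPropositional as DecMembership
open import Data.List.Relation.Binary.Permutation.Propositional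
  using (_↭_; refl; prep; swap; trans; ↭-refl; ↭-sym; ↭-trans; ↭-reflexive; ↭⇒↭ₛ)
open import Data.List.Relation.Binary.Permutation.Propositional.Properties
  using (∈-resp-↭; All-resp-↭; ++↭ʳ++; ++⁺ˡ; ++⁺ʳ; shift; shifts; ++-comm; ↭-map-inv)
import Data.List.Relation.Binary.Permutation.Setoid.Properties as PermutationSetoid
open import Data.List.Relation.Unary.All as All using (All; []; _∷_)
import Data.List.Relation.Unary.All.Properties as All
open import Data.List.Relation.Unary.AllPairs as AllPairs using (AllPairs; []; _∷_; allPairs?)
import Data.List.Relation.Unary.AllPairs.Properties as AllPairs
open import Data.List.Relation.Unary.Any using (here; there)
open import Data.List.Relation.Unary.Unique.Propositional using (Unique)
import Data.List.Relation.Unary.Unique.Propositional.Properties as Unique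
open import Data.Nat using (ℕ; zero; suc; _+_; _*_; _%_; _≤_; _<_; z≤n; s≤s)
open import Data.Nat.DivMod using ([m+kn]%n≡m%n)
import Data.Nat.Properties as ℕ
open import Data.Nat.Tactic.RingSolver using (solve-∀)
open import Data.Product as Prod using (∃; ∃₂; _×_; _,_; proj₁; proj₂; uncurry)
import Data.Product.Properties as Prod
open import Data.Sum as Sum using (_⊎_; inj₁; inj₂; [_,_])
open import Data.Sum.Properties using (inj₁-injective)
open import Data.Unit using (⊤; tt)
import Data.Vec as Vec
import Data.Vec.Properties as Vec
open import Function using (_∘_; id)
open import Function.Bundles using (mk⇔; Equivalence; mk⤖; Inverse)
open import Function.Properties.Bijection using (⤖⇒↔)
open import Relation.Binary.Definitions using (tri<; tri≈; tri>)
open import Relation.Binary.PropositionalEquality as ≡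
  using (_≡_; _≢_; refl; sym; cong; cong₂; subst; subst₂)
open import Relation.Binary.PropositionalEquality.Properties using (setoid)
open import Relation.Nullary using (¬_; Dec; yes; no)
open import Relation.Nullary.Decidable
  using (_×-dec_; _⊎-dec_; _→-dec_; ¬?; map′; from-yes)

-- The isolates exceed all other labels when a component is appended. A cycle is started from two
-- isolates p < q and leaves two; a path can be started from two or from one, and leaves one. Hence
-- the cycles come before the paths, and the final number of isolates is the minimum degree. The
-- obstacle is C₄. Started from p and q it has the labels p, q, p + q, p + 2q, and its isolates
-- would be 2p + 2q and 2p + 3q. They differ by the label q, so q would be joined to the isolate 2p
-- + 2q. For a triangle the two isolates differ by q - p, which is not a label; on five or more
-- vertices the difference falls strictly between two labels that are neighbours in size. C₄
-- therefore needs labels that are not Fibonacci-like. An even number of copies grows by twos from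
-- nothing, an odd number from three copies, and a single copy is paired with another component
-- whose labels absorb its edge sums.

variable
  A B : Set

-- Paths and cycles in a graph

data Piece (A : Set) : Set where
  path cycle : List A → Piece A

verts : Piece A → List A
verts (path xs)  = xs
verts (cycle xs) = xs

links : List A → List (A × A)
links (x ∷ y ∷ zs) = (x , y) ∷ links (y ∷ zs)
links _            = []

final : A → List A → A
final x []       = x
final x (y ∷ ys) = final y ys

closing : List A → List (A × A)
closing []       = []
closing (x ∷ xs) = (final x xs , x) ∷ []

edges : Piece A → List (A × A)
edges (path xs)  = links xs
edges (cycle xs) = closing xs ++ links xs

allVerts : List (Piece A) → List A
allVerts = concatMap verts

allEdges : List (Piece A) → List (A × A)
allEdges = concatMap edges

Joined : List (A × A) → A → A → Set
Joined E a b = (a , b) ∈ E ⊎ (b , a) ∈ E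

-- A path on one vertex is allowed, since deleting vertices can isolate others. A cycle has at least
-- three vertices because graphs are simple.
data Valid {A : Set} : Piece A → Set where
  path  : ∀ {x xs} → Valid (path (x ∷ xs))
  cycle : ∀ {x y z zs} → Valid (cycle (x ∷ y ∷ z ∷ zs))

Joined-sym : ∀ {E : List (A × A)} {a b} → Joined E a b → Joined E b a
Joined-sym = Sum.swap

Joined-++⁺ˡ : ∀ {E F : List (A × A)} {a b} → Joined E a b → Joined (E ++ F) a b
Joined-++⁺ˡ = Sum.map ∈-++⁺ˡ ∈-++⁺ˡ

Joined-++⁺ʳ : ∀ (E : List (A × A)) {F a b} → Joined F a b → Joined (E ++ F) a b
Joined-++⁺ʳ E = Sum.map (∈-++⁺ʳ E) (∈-++⁺ʳ E)

Joined-++⁻ : ∀ (E : List (A × A)) {F a b} → Joined (E ++ F) a b → Joined E a b ⊎ Joined F a b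
Joined-++⁻ E (inj₁ p) = Sum.map inj₁ inj₁ (∈-++⁻ E p)
Joined-++⁻ E (inj₂ p) = Sum.map inj₂ inj₂ (∈-++⁻ E p)

Joined-∷ : ∀ {E : List (A × A)} {e a b} → Joined E a b → Joined (e ∷ E) a b
Joined-∷ = Sum.map there there

Joined-↭ : ∀ {E F : List (A × A)} → E ↭ F → ∀ {a b} → Joined E a b → Joined F a b
Joined-↭ σ = Sum.map (∈-resp-↭ σ) (∈-resp-↭ σ)

concatMap-↭ : ∀ {f : A → List B} {xs ys} → xs ↭ ys → concatMap f xs ↭ concatMap f ys
concatMap-↭ refl = ↭-refl
concatMap-↭ {f = f} (prep x σ) = ++⁺ˡ (f x) (concatMap-↭ σ)
concatMap-↭ {f = f} {ys = _ ∷ _ ∷ ys} (swap x y σ) =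
  ↭-trans (++⁺ˡ (f x) (++⁺ˡ (f y) (concatMap-↭ σ))) (shifts (f x) (f y))
concatMap-↭ (trans σ τ) = ↭-trans (concatMap-↭ σ) (concatMap-↭ τ)

Unique-↭ : {xs ys : List A} → xs ↭ ys → Unique xs → Unique ys
Unique-↭ σ = PermutationSetoid.Unique-resp-↭ (setoid _) (↭⇒↭ₛ σ)

Unique-++ˡ : (xs : List A) {ys : List A} → Unique (xs ++ ys) → Unique xs
Unique-++ˡ []       _       = []
Unique-++ˡ (x ∷ xs) (p ∷ u) = All.++⁻ˡ xs p ∷ Unique-++ˡ xs u

Unique-++ʳ : (xs : List A) {ys : List A} → Unique (xs ++ ys) → Unique ys
Unique-++ʳ []       u       = u
Unique-++ʳ (x ∷ xs) (_ ∷ u) = Unique-++ʳ xs u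

Unique-disjoint : (xs : List A) {ys : List A} → Unique (xs ++ ys) → ∀ {a} → a ∈ xs → a ∈ ys → ⊥
Unique-disjoint (x ∷ xs) (p ∷ u) (here refl) b = All.lookup (All.++⁻ʳ xs p) b refl
Unique-disjoint (x ∷ xs) (p ∷ u) (there a)   b = Unique-disjoint xs u a b

Unique-head : ∀ {x y : A} {xs} → Unique (x ∷ xs) → y ∈ xs → x ≢ y
Unique-head (p ∷ _) = All.lookup p

final-∈ : ∀ (x : A) xs → final x xs ∈ x ∷ xs
final-∈ x []       = here refl
final-∈ x (y ∷ ys) = there (final-∈ y ys)

links-∈ : ∀ (xs : List A) {a b} → (a , b) ∈ links xs → a ∈ xs × b ∈ xs
links-∈ (x ∷ y ∷ zs) (here refl) = here refl , there (here refl)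
links-∈ (x ∷ y ∷ zs) (there p) with links-∈ (y ∷ zs) p
... | a∈ , b∈ = there a∈ , there b∈

edges-∈ : ∀ (P : Piece A) {a b} → (a , b) ∈ edges P → a ∈ verts P × b ∈ verts P
edges-∈ (path xs)        p           = links-∈ xs p
edges-∈ (cycle (x ∷ xs)) (here refl) = final-∈ x xs , here refl
edges-∈ (cycle (x ∷ xs)) (there p)   = links-∈ (x ∷ xs) p

allEdges-∈ : ∀ (D : List (Piece A)) {a b} → (a , b) ∈ allEdges D → a ∈ allVerts D × b ∈ allVerts D
allEdges-∈ (P ∷ D) p with ∈-++⁻ (edges P) p
... | inj₁ q = let a∈ , b∈ = edges-∈ P q in ∈-++⁺ˡ a∈ , ∈-++⁺ˡ b∈
... | inj₂ q = let a∈ , b∈ = allEdges-∈ D q in ∈-++⁺ʳ (verts P) a∈ , ∈-++⁺ʳ (verts P) b∈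

Joined-∈ : ∀ (D : List (Piece A)) {a b} → Joined (allEdges D) a b → a ∈ allVerts D
Joined-∈ D (inj₁ p) = proj₁ (allEdges-∈ D p)
Joined-∈ D (inj₂ p) = proj₂ (allEdges-∈ D p)

Joined-local : ∀ (P : Piece A) D {a b} → Unique (allVerts (P ∷ D)) → a ∈ verts P →
               Joined (allEdges (P ∷ D)) a b → Joined (edges P) a b
Joined-local P D u a∈ j with Joined-++⁻ (edges P) j
... | inj₁ k = k
... | inj₂ k = ⊥-elim (Unique-disjoint (verts P) u a∈ (Joined-∈ D k))

-- The part before `a` is kept reversed, so that both neighbours of `a` in the list are heads and
-- can be matched on.
split : ∀ {a} {xs : List A} → a ∈ xs → ∃₂ λ as bs → xs ≡ as ʳ++ (a ∷ bs)
split (here refl) = [] , _ , refl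
split {a = a} (there {y} p) with split p
... | as , bs , refl = as ++ (y ∷ []) , bs , sym (++-ʳ++ as)

-- Reversing the left arm turns its links around; this is why `Joined` appears here and not
-- membership.
links-ʳ++⁻ : ∀ (as : List A) {u bs x y} → Joined (links (as ʳ++ (u ∷ bs))) x y →
             Joined (links (u ∷ as)) x y ⊎ Joined (links (u ∷ bs)) x y
links-ʳ++⁻ []       j = inj₂ j
links-ʳ++⁻ (a ∷ as) j with links-ʳ++⁻ as j
... | inj₁ k                  = inj₁ (Joined-∷ k)
... | inj₂ (inj₁ (here refl)) = inj₁ (inj₂ (here refl))
... | inj₂ (inj₂ (here refl)) = inj₁ (inj₁ (here refl))
... | inj₂ (inj₁ (there p))   = inj₂ (inj₁ p)
... | inj₂ (inj₂ (there p))   = inj₂ (inj₂ p)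

links-ʳ++⁺ʳ : ∀ (as : List A) {u bs x y} → Joined (links (u ∷ bs)) x y →
              Joined (links (as ʳ++ (u ∷ bs))) x y
links-ʳ++⁺ʳ []       j = j
links-ʳ++⁺ʳ (a ∷ as) j = links-ʳ++⁺ʳ as (Joined-∷ j)

links-ʳ++⁺ˡ : ∀ (as : List A) {u bs x y} → Joined (links (u ∷ as)) x y →
              Joined (links (as ʳ++ (u ∷ bs))) x y
links-ʳ++⁺ˡ (a ∷ as) (inj₁ (here refl)) = links-ʳ++⁺ʳ as (inj₂ (here refl))
links-ʳ++⁺ˡ (a ∷ as) (inj₂ (here refl)) = links-ʳ++⁺ʳ as (inj₁ (here refl))
links-ʳ++⁺ˡ (a ∷ as) (inj₁ (there p))   = links-ʳ++⁺ˡ as (inj₁ p)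
links-ʳ++⁺ˡ (a ∷ as) (inj₂ (there p))   = links-ʳ++⁺ˡ as (inj₂ p)

final-ʳ++ : ∀ (a : A) as us → ∃₂ λ h t → (a ∷ as) ʳ++ us ≡ h ∷ t × final h t ≡ final a us × h ∈ a ∷ as
final-ʳ++ a []        us = a , us , refl , refl , here refl
final-ʳ++ a (a′ ∷ as) us with final-ʳ++ a′ as (a ∷ us)
... | h , t , eq , f , m = h , t , eq , f , there m

AtMostOne : (A → A → Set) → A → Set
AtMostOne R u = ∀ {y z} → R u y → R u z → y ≡ z

links-interior : ∀ {u a b : A} {as bs} →
                 Joined (links ((a ∷ as) ʳ++ (u ∷ b ∷ bs))) u a ×
                 Joined (links ((a ∷ as) ʳ++ (u ∷ b ∷ bs))) u b
links-interior {u = u} {a} {b} {as} {bs} =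
  links-ʳ++⁺ˡ (a ∷ as) (inj₁ (here refl)) , links-ʳ++⁺ʳ (a ∷ as) (inj₁ (here refl))

Unique-ʳ++ : ∀ (as : List A) {bs} → Unique (as ʳ++ bs) → Unique (as ++ bs)
Unique-ʳ++ as {bs} = Unique-↭ (↭-sym (++↭ʳ++ as bs))

interior-≢ : ∀ {u a b : A} {as bs} → Unique ((a ∷ as) ʳ++ (u ∷ b ∷ bs)) → a ≢ b
interior-≢ {a = a} {as = as} uq refl =
  Unique-disjoint (a ∷ as) (Unique-ʳ++ (a ∷ as) uq) (here refl) (there (here refl))

cycle-two-neighbours : ∀ {xs : List A} {u} → Valid (cycle xs) → Unique xs → u ∈ xs →
                       ∃₂ λ y z → y ≢ z × Joined (edges (cycle xs)) u y × Joined (edges (cycle xs)) u z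
cycle-two-neighbours v uq u∈ with split u∈
cycle-two-neighbours (cycle {_} {y} {z} {zs}) (p ∷ q ∷ _) u∈ | [] , _ , refl =
  y , final z zs , All.lookup q (final-∈ z zs) , inj₁ (there (here refl)) , inj₂ (here refl)
cycle-two-neighbours v uq u∈ | a ∷ as , b ∷ bs , refl =
  let j , k = links-interior {as = as} {bs} in
  a , b , interior-≢ {as = as} uq , Joined-++⁺ʳ (closing _) j , Joined-++⁺ʳ (closing _) k
cycle-two-neighbours () uq u∈ | a ∷ [] , [] , refl
-- The last vertex of the cycle has its predecessor `a` and, through `closing`, the first vertex `h`
-- as neighbours.
cycle-two-neighbours {u = u} v uq u∈ | a ∷ a′ ∷ as , [] , refl with final-ʳ++ a′ as (a ∷ u ∷ [])
... | h , t , eq , f , h∈ =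
  h , a , (λ { refl → Unique-disjoint (a′ ∷ as) (Unique-ʳ++ (a′ ∷ as) uq) h∈ (here refl) }) ,
  subst (λ xs → Joined (edges (cycle xs)) u h) (sym eq) (inj₁ (here (cong₂ _,_ (sym f) refl))) ,
  Joined-++⁺ʳ (closing _) (links-ʳ++⁺ʳ (a′ ∷ as) {bs = u ∷ []} (inj₂ (here refl)))

module _ {A : Set} where
  -- Reversing a path turns the edges `(a , b)` into `(b , a)`, so two descriptions of one graph
  -- need not have edge lists that are permutations of each other; only `Joined` is compared.
  record _≈_ (D D′ : List (Piece A)) : Set where
    field
      same-verts : allVerts D ↭ allVerts D′
      forth         : ∀ {a b} → Joined (allEdges D) a b → Joined (allEdges D′) a b
      back       : ∀ {a b} → Joined (allEdges D′) a b → Joined (allEdges D) a b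
  open _≈_ public

↭⇒≈ : ∀ {D D′ : List (Piece A)} → D ↭ D′ → D ≈ D′
↭⇒≈ σ = record
  { same-verts = concatMap-↭ σ
  ; forth         = Joined-↭ (concatMap-↭ σ)
  ; back       = Joined-↭ (↭-sym (concatMap-↭ σ))
  }

≈-trans : ∀ {D D′ D″ : List (Piece A)} → D ≈ D′ → D′ ≈ D″ → D ≈ D″
≈-trans p q = record
  { same-verts = ↭-trans (same-verts p) (same-verts q)
  ; forth         = forth q ∘ forth p
  ; back       = back p ∘ back q
  }

≈-flip : ∀ (as : List A) u D → (path (as ʳ++ (u ∷ [])) ∷ D) ≈ (path (u ∷ as) ∷ D)
≈-flip as u D = record
  { same-verts = ++⁺ʳ (allVerts D) (↭-trans (↭-sym (++↭ʳ++ as (u ∷ []))) (++-comm as (u ∷ [])))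
  ; forth   = λ j → [ (λ k → [ Joined-++⁺ˡ , (λ { (inj₁ ()) ; (inj₂ ()) }) ] (links-ʳ++⁻ as k))
                 , Joined-++⁺ʳ (links (u ∷ as)) ] (Joined-++⁻ (links (as ʳ++ (u ∷ []))) j)
  ; back = λ j → [ Joined-++⁺ˡ ∘ links-ʳ++⁺ˡ as
                 , Joined-++⁺ʳ (links (as ʳ++ (u ∷ []))) ] (Joined-++⁻ (links (u ∷ as)) j)
  }

piece-of : ∀ (D : List (Piece A)) {u} → u ∈ allVerts D → ∃₂ λ P D′ → u ∈ verts P × D ↭ P ∷ D′
piece-of (P ∷ D) u∈ with ∈-++⁻ (verts P) u∈
... | inj₁ q = P , D , q , ↭-refl
... | inj₂ q with piece-of D q
...   | Q , D′ , r , σ = Q , P ∷ D′ , r , ↭-trans (prep P σ) (swap P Q ↭-refl)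

-- A vertex of a cycle and an inner vertex of a path have two distinct neighbours. So `u` is an end
-- of a path, which is reversed if `u` is its last vertex.
extract : ∀ {D : List (Piece A)} {u} → All Valid D → Unique (allVerts D) → u ∈ allVerts D →
          AtMostOne (Joined (allEdges D)) u →
          ∃₂ λ ys D′ → All Valid (path (u ∷ ys) ∷ D′) × D ≈ (path (u ∷ ys) ∷ D′)
extract {D = D} va uq u∈ one with piece-of D u∈
... | cycle xs , D′ , u∈′ , σ with All-resp-↭ σ va | Unique-↭ (concatMap-↭ σ) uq
...   | v ∷ _ | uq′ with cycle-two-neighbours v (Unique-++ˡ xs uq′) u∈′
...     | y , z , y≢z , j , k =
  ⊥-elim (y≢z (one (back (↭⇒≈ σ) (Joined-++⁺ˡ j)) (back (↭⇒≈ σ) (Joined-++⁺ˡ k))))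
extract va uq u∈ one | path xs , D′ , u∈′ , σ with split u∈′
... | [] , bs , refl = bs , D′ , path ∷ All.tail (All-resp-↭ σ va) , ↭⇒≈ σ
... | as , [] , refl = as , D′ , path ∷ All.tail (All-resp-↭ σ va) , ≈-trans (↭⇒≈ σ) (≈-flip as _ D′)
... | a ∷ as , b ∷ bs , refl =
  let j , k = links-interior {as = as} {bs} in
  ⊥-elim (interior-≢ {as = as} (Unique-++ˡ ((a ∷ as) ʳ++ _) (Unique-↭ (concatMap-↭ σ) uq))
    (one (back (↭⇒≈ σ) (Joined-++⁺ˡ j)) (back (↭⇒≈ σ) (Joined-++⁺ˡ k))))

final-snoc : ∀ {x w : A} as → final x (as ʳ++ (w ∷ [])) ≡ w
final-snoc         []       = refl
final-snoc {w = w} (a ∷ as) with final-ʳ++ a as (w ∷ [])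
... | h , t , eq , f , _ = ≡.trans (cong (final _) eq) f

Joined-links-∷ : ∀ {x y u : A} ys → Joined (links ys) x y → Joined (links (u ∷ ys)) x y
Joined-links-∷ (_ ∷ _) j = Joined-∷ j
Joined-links-∷ []      (inj₁ ())
Joined-links-∷ []      (inj₂ ())

-- At any other position `w` would have both a predecessor and a successor, and these are distinct.
end-final : ∀ {u w : A} {ys} → Unique (u ∷ ys) → w ∈ ys → AtMostOne (Joined (links (u ∷ ys))) w →
            final u ys ≡ w
end-final uq w∈ one with split w∈
... | as , [] , refl = final-snoc as
... | [] , b ∷ bs , refl =
  ⊥-elim (Unique-head uq (there (here refl)) (one (inj₂ (here refl)) (inj₁ (there (here refl)))))
... | a ∷ as , b ∷ bs , refl =
  let j , k = links-interior {as = as} {bs} in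
  ⊥-elim (interior-≢ {as = as} (Unique-++ʳ (_ ∷ []) uq)
    (one (Joined-links-∷ ((a ∷ as) ʳ++ _) j) (Joined-links-∷ ((a ∷ as) ʳ++ _) k)))

-- Pieces under a map of their vertices

mapPiece : (A → B) → Piece A → Piece B
mapPiece f (path xs)  = path (map f xs)
mapPiece f (cycle xs) = cycle (map f xs)

verts-map : ∀ (f : A → B) P → verts (mapPiece f P) ≡ map f (verts P)
verts-map f (path xs)  = refl
verts-map f (cycle xs) = refl

final-map : ∀ (f : A → B) x xs → final (f x) (map f xs) ≡ f (final x xs)
final-map f x []       = refl
final-map f x (y ∷ ys) = final-map f y ys

links-map : ∀ (f : A → B) xs → links (map f xs) ≡ map (Prod.map f f) (links xs)
links-map f []           = refl
links-map f (x ∷ [])     = refl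
links-map f (x ∷ y ∷ zs) = cong (_ ∷_) (links-map f (y ∷ zs))

edges-map : ∀ (f : A → B) P → edges (mapPiece f P) ≡ map (Prod.map f f) (edges P)
edges-map f (path xs)        = links-map f xs
edges-map f (cycle [])       = refl
edges-map f (cycle (x ∷ xs)) = cong₂ _∷_ (cong (_, f x) (final-map f x xs)) (links-map f (x ∷ xs))

allVerts-map : ∀ (f : A → B) D → allVerts (map (mapPiece f) D) ≡ map f (allVerts D)
allVerts-map f []      = refl
allVerts-map f (P ∷ D) =
  ≡.trans (cong₂ _++_ (verts-map f P) (allVerts-map f D)) (sym (map-++ f (verts P) (allVerts D)))

allEdges-map : ∀ (f : A → B) D → allEdges (map (mapPiece f) D) ≡ map (Prod.map f f) (allEdges D)
allEdges-map f []      = refl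
allEdges-map f (P ∷ D) =
  ≡.trans (cong₂ _++_ (edges-map f P) (allEdges-map f D)) (sym (map-++ _ (edges P) (allEdges D)))

Valid-map : ∀ {f : A → B} {P} → Valid P → Valid (mapPiece f P)
Valid-map path  = path
Valid-map cycle = cycle

Joined-map⁺ : ∀ (f : A → B) {E a b} → Joined E a b → Joined (map (Prod.map f f) E) (f a) (f b)
Joined-map⁺ f = Sum.map (∈-map⁺ _) (∈-map⁺ _)

Joined-map⁻ : ∀ (f : A → B) {E x y} → Joined (map (Prod.map f f) E) x y →
              ∃₂ λ a b → x ≡ f a × y ≡ f b × Joined E a b
Joined-map⁻ f (inj₁ p) with ∈-map⁻ _ p
... | (a , b) , q , refl = a , b , refl , refl , inj₁ q
Joined-map⁻ f (inj₂ p) with ∈-map⁻ _ p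
... | (a , b) , q , refl = b , a , refl , refl , inj₂ q

-- Decomposition by adding one vertex

NoThree : ∀ {n} → Graph n → Set
NoThree G = ∀ {v x y z} → adj G v x ≡ true → adj G v y ≡ true → adj G v z ≡ true →
            x ≡ y ⊎ x ≡ z ⊎ y ≡ z

record Decomposition {n} (G : Graph n) : Set where
  field
    pieces   : List (Piece (Fin n))
    valid    : All Valid pieces
    distinct   : Unique (allVerts pieces)
    spanning : ∀ v → v ∈ allVerts pieces
    adj⇒     : ∀ {u v} → adj G u v ≡ true → Joined (allEdges pieces) u v
    ⇒adj     : ∀ {u v} → Joined (allEdges pieces) u v → adj G u v ≡ true

delete₀ : ∀ {n} → Graph (suc n) → Graph n
delete₀ G = record
  { adj    = λ i j → adj G (suc i) (suc j)
  ; sym    = λ i j → adj-sym G (suc i) (suc j)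
  ; irrefl = λ i → irrefl G (suc i)
  }

module Extend {n} (G : Graph (suc n)) (no3 : NoThree G) (Δ : Decomposition (delete₀ G)) where
  open Decomposition Δ

  D : List (Piece (Fin (suc n)))
  D = map (mapPiece suc) pieces

  D-valid : All Valid D
  D-valid = All.map⁺ (All.map Valid-map valid)

  D-unique : Unique (allVerts D)
  D-unique = subst Unique (sym (allVerts-map suc pieces)) (Unique.map⁺ Fin.suc-injective distinct)

  D-complete : ∀ v → suc v ∈ allVerts D
  D-complete v = subst (suc v ∈_) (sym (allVerts-map suc pieces)) (∈-map⁺ suc (spanning v))

  D-no-zero : ∀ {v} → v ∈ allVerts D → zero ≢ v
  D-no-zero v∈ refl with ∈-map⁻ suc (subst (zero ∈_) (allVerts-map suc pieces) v∈)
  ... | _ , _ , ()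

  D-adj⇒ : ∀ {u v} → adj G (suc u) (suc v) ≡ true → Joined (allEdges D) (suc u) (suc v)
  D-adj⇒ e = subst (λ E → Joined E _ _) (sym (allEdges-map suc pieces)) (Joined-map⁺ suc (adj⇒ e))

  D-⇒adj : ∀ {x y} → Joined (allEdges D) x y → adj G x y ≡ true
  D-⇒adj j with Joined-map⁻ suc {allEdges pieces} (subst (λ E → Joined E _ _) (allEdges-map suc pieces) j)
  ... | a , b , refl , refl , k = ⇒adj k

  flip-adj : ∀ {x y} → adj G x y ≡ true → adj G y x ≡ true
  flip-adj e = ≡.trans (adj-sym G _ _) e

  -- The vertex `zero` already takes one of the at most two neighbours of `u`.
  D-one : ∀ {u} → adj G zero u ≡ true → AtMostOne (Joined (allEdges D)) u
  D-one e j k with no3 (flip-adj e) (D-⇒adj j) (D-⇒adj k)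
  ... | inj₁ z        = ⊥-elim (D-no-zero (Joined-∈ D (Joined-sym {E = allEdges D} j)) z)
  ... | inj₂ (inj₁ z) = ⊥-elim (D-no-zero (Joined-∈ D (Joined-sym {E = allEdges D} k)) z)
  ... | inj₂ (inj₂ e) = e

  star : List (Fin n) → List (Fin (suc n) × Fin (suc n))
  star = map (λ u → zero , suc u)

  build : ∀ ns {D′} → All Valid D′ → allVerts D′ ↭ zero ∷ allVerts D →
          (∀ {x y} → Joined (allEdges D′) x y → Joined (star ns ++ allEdges D) x y) →
          (∀ {x y} → Joined (star ns ++ allEdges D) x y → Joined (allEdges D′) x y) →
          (∀ {u} → u ∈ ns → adj G zero (suc u) ≡ true) →
          (∀ {u} → adj G zero (suc u) ≡ true → u ∈ ns) →
          Decomposition G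
  build ns {D′} va σ dn up ns⇒ ⇒ns = record
    { pieces   = D′
    ; valid    = va
    ; distinct   = Unique-↭ (↭-sym σ) (All.tabulate D-no-zero ∷ D-unique)
    ; spanning = λ { zero    → ∈-resp-↭ (↭-sym σ) (here refl)
                   ; (suc v) → ∈-resp-↭ (↭-sym σ) (there (D-complete v)) }
    ; adj⇒     = up ∘ ⇒joined
    ; ⇒adj     = [ star⇒ , D-⇒adj ] ∘ Joined-++⁻ (star ns) ∘ dn
    }
    where
    ⇒joined : ∀ {x y} → adj G x y ≡ true → Joined (star ns ++ allEdges D) x y
    ⇒joined {zero}  {zero}  e with ≡.trans (sym e) (irrefl G zero)
    ... | ()
    ⇒joined {zero}  {suc v} e = Joined-++⁺ˡ (inj₁ (∈-map⁺ _ (⇒ns e)))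
    ⇒joined {suc u} {zero}  e = Joined-++⁺ˡ (inj₂ (∈-map⁺ _ (⇒ns (flip-adj e))))
    ⇒joined {suc u} {suc v} e = Joined-++⁺ʳ (star ns) (D-adj⇒ e)
    star⇒ : ∀ {x y} → Joined (star ns) x y → adj G x y ≡ true
    star⇒ (inj₁ p) with ∈-map⁻ _ p
    ... | u , u∈ , refl = ns⇒ u∈
    star⇒ (inj₂ p) with ∈-map⁻ _ p
    ... | u , u∈ , refl = flip-adj (ns⇒ u∈)

  isolated : (∀ u → adj G zero (suc u) ≢ true) → Decomposition G
  isolated none = build [] {path (zero ∷ []) ∷ D} (path ∷ D-valid) ↭-refl id id (λ ())
                        (λ e → ⊥-elim (none _ e))

  pendant : ∀ {u} → adj G zero (suc u) ≡ true → (∀ {v} → adj G zero (suc v) ≡ true → v ≡ u) →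
            Decomposition G
  pendant {u} e only with extract D-valid D-unique (D-complete u) (D-one e)
  ... | ys , D₁ , va , eq =
    build (u ∷ []) {path (zero ∷ suc u ∷ ys) ∷ D₁} (path ∷ All.tail va)
          (prep zero (↭-sym (same-verts eq))) dn up
          (λ { (here refl) → e }) (λ e′ → here (only e′))
    where
    dn : ∀ {x y} → Joined ((zero , suc u) ∷ links (suc u ∷ ys) ++ allEdges D₁) x y →
         Joined ((zero , suc u) ∷ allEdges D) x y
    dn = [ Joined-++⁺ˡ , Joined-++⁺ʳ ((zero , suc u) ∷ []) ∘ back eq ] ∘ Joined-++⁻ ((zero , suc u) ∷ [])
    up : ∀ {x y} → Joined ((zero , suc u) ∷ allEdges D) x y →
         Joined ((zero , suc u) ∷ links (suc u ∷ ys) ++ allEdges D₁) x y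
    up = [ Joined-++⁺ˡ , Joined-++⁺ʳ ((zero , suc u) ∷ []) ∘ forth eq ] ∘ Joined-++⁻ ((zero , suc u) ∷ [])

  module _ {u w} (u≢w : u ≢ w) (eu : adj G zero (suc u) ≡ true) (ew : adj G zero (suc w) ≡ true) where

    two⇒ : ∀ {v} → v ∈ u ∷ w ∷ [] → adj G zero (suc v) ≡ true
    two⇒ (here refl)         = eu
    two⇒ (there (here refl)) = ew

    ⇒two : ∀ {v} → adj G zero (suc v) ≡ true → v ∈ u ∷ w ∷ []
    ⇒two ev with no3 eu ew ev
    ... | inj₁ e        = ⊥-elim (u≢w (Fin.suc-injective e))
    ... | inj₂ (inj₁ e) = here (sym (Fin.suc-injective e))
    ... | inj₂ (inj₂ e) = there (here (sym (Fin.suc-injective e)))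

    -- Here `u` and `w` are the two ends of one path, which `zero` closes. As `u ≢ w`, the path has
    -- at least two vertices and the cycle at least three.
    close : ∀ ys {D₁} → All Valid D₁ → D ≈ (path (suc u ∷ ys) ∷ D₁) → final (suc u) ys ≡ suc w →
            Decomposition G
    close []           va eq f = ⊥-elim (u≢w (Fin.suc-injective f))
    close ys@(_ ∷ _) {D₁} va eq f =
      build (u ∷ w ∷ []) {cycle (zero ∷ suc u ∷ ys) ∷ D₁} (cycle ∷ va)
            (prep zero (↭-sym (same-verts eq))) dn up two⇒ ⇒two
      where
      C : List (Fin (suc n) × Fin (suc n))
      C = (final (suc u) ys , zero) ∷ (zero , suc u) ∷ []
      C⇒ : ∀ {x y} → Joined C x y → Joined (star (u ∷ w ∷ [])) x y
      C⇒ (inj₁ (here refl))         = inj₂ (there (here (cong (zero ,_) f)))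
      C⇒ (inj₁ (there (here refl))) = inj₁ (here refl)
      C⇒ (inj₂ (here refl))         = inj₁ (there (here (cong (zero ,_) f)))
      C⇒ (inj₂ (there (here refl))) = inj₂ (here refl)
      ⇒C : ∀ {x y} → Joined (star (u ∷ w ∷ [])) x y → Joined C x y
      ⇒C (inj₁ (here refl))         = inj₁ (there (here refl))
      ⇒C (inj₁ (there (here refl))) = inj₂ (here (cong (_, zero) (sym f)))
      ⇒C (inj₂ (here refl))         = inj₂ (there (here refl))
      ⇒C (inj₂ (there (here refl))) = inj₁ (here (cong (_, zero) (sym f)))
      dn : ∀ {x y} → Joined (C ++ links (suc u ∷ ys) ++ allEdges D₁) x y →
           Joined (star (u ∷ w ∷ []) ++ allEdges D) x y
      dn = [ Joined-++⁺ˡ ∘ C⇒ , Joined-++⁺ʳ (star (u ∷ w ∷ [])) ∘ back eq ] ∘ Joined-++⁻ C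
      up : ∀ {x y} → Joined (star (u ∷ w ∷ []) ++ allEdges D) x y →
           Joined (C ++ links (suc u ∷ ys) ++ allEdges D₁) x y
      up = [ Joined-++⁺ˡ ∘ ⇒C , Joined-++⁺ʳ C ∘ forth eq ] ∘ Joined-++⁻ (star (u ∷ w ∷ []))

    -- Here `u` and `w` are ends of different paths: the first is read towards `u`, then come `zero`
    -- and the second path from `w` on.
    splice : ∀ ys zs {D₁ D₂} → All Valid D₂ → D ≈ (path (suc u ∷ ys) ∷ D₁) →
             D₁ ≈ (path (suc w ∷ zs) ∷ D₂) → Decomposition G
    splice ys zs {D₁} {D₂} va eq₁ eq₂ =
      build (u ∷ w ∷ []) {path long ∷ D₂} (long-valid ys ∷ va) σ dn up two⇒ ⇒two
      where
      long : List (Fin (suc n))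
      long = ys ʳ++ (suc u ∷ zero ∷ suc w ∷ zs)
      long-valid : ∀ ys {x xs} → Valid (path (ys ʳ++ (x ∷ xs)))
      long-valid []       = path
      long-valid (y ∷ ys) = long-valid ys
      σ : long ++ allVerts D₂ ↭ zero ∷ allVerts D
      σ = ↭-trans (++⁺ʳ (allVerts D₂) (↭-trans (↭-sym (++↭ʳ++ ys _)) (shift (suc u) ys _)))
         (↭-trans (++⁺ʳ (allVerts D₂) (prep (suc u) (shift zero ys _)))
         (↭-trans (swap (suc u) zero (↭-reflexive (++-assoc-≡ ys (suc w ∷ zs) (allVerts D₂))))
         (prep zero (↭-sym (↭-trans (same-verts eq₁) (prep (suc u) (++⁺ˡ ys (same-verts eq₂))))))))
      beyond-w : ∀ {x y} → Joined (links (suc w ∷ zs)) x y → Joined (star (u ∷ w ∷ []) ++ allEdges D) x y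
      beyond-w l = Joined-++⁺ʳ (star _) (back eq₁ (Joined-++⁺ʳ (links (suc u ∷ ys)) (back eq₂ (Joined-++⁺ˡ l))))
      dn : ∀ {x y} → Joined (links long ++ allEdges D₂) x y → Joined (star (u ∷ w ∷ []) ++ allEdges D) x y
      dn j with Joined-++⁻ (links long) j
      ... | inj₂ k = Joined-++⁺ʳ (star _) (back eq₁ (Joined-++⁺ʳ (links (suc u ∷ ys))
                       (back eq₂ (Joined-++⁺ʳ (links (suc w ∷ zs)) k))))
      ... | inj₁ k with links-ʳ++⁻ ys k
      ...   | inj₁ l                          = Joined-++⁺ʳ (star _) (back eq₁ (Joined-++⁺ˡ l))
      ...   | inj₂ (inj₁ (here refl))         = inj₂ (here refl)
      ...   | inj₂ (inj₂ (here refl))         = inj₁ (here refl)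
      ...   | inj₂ (inj₁ (there (here refl))) = inj₁ (there (here refl))
      ...   | inj₂ (inj₂ (there (here refl))) = inj₂ (there (here refl))
      ...   | inj₂ (inj₁ (there (there p)))   = beyond-w (inj₁ p)
      ...   | inj₂ (inj₂ (there (there p)))   = beyond-w (inj₂ p)
      up : ∀ {x y} → Joined (star (u ∷ w ∷ []) ++ allEdges D) x y → Joined (links long ++ allEdges D₂) x y
      up j with Joined-++⁻ (star (u ∷ w ∷ [])) j
      ... | inj₁ (inj₁ (here refl))         = Joined-++⁺ˡ (links-ʳ++⁺ʳ ys (inj₂ (here refl)))
      ... | inj₁ (inj₂ (here refl))         = Joined-++⁺ˡ (links-ʳ++⁺ʳ ys (inj₁ (here refl)))
      ... | inj₁ (inj₁ (there (here refl))) = Joined-++⁺ˡ (links-ʳ++⁺ʳ ys (inj₁ (there (here refl))))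
      ... | inj₁ (inj₂ (there (here refl))) = Joined-++⁺ˡ (links-ʳ++⁺ʳ ys (inj₂ (there (here refl))))
      ... | inj₂ k with Joined-++⁻ (links (suc u ∷ ys)) (forth eq₁ k)
      ...   | inj₁ l = Joined-++⁺ˡ (links-ʳ++⁺ˡ ys l)
      ...   | inj₂ l with Joined-++⁻ (links (suc w ∷ zs)) (forth eq₂ l)
      ...     | inj₁ m = Joined-++⁺ˡ (links-ʳ++⁺ʳ ys (Joined-∷ (Joined-∷ m)))
      ...     | inj₂ m = Joined-++⁺ʳ (links long) m

    bridge : Decomposition G
    bridge with extract D-valid D-unique (D-complete u) (D-one eu)
    ... | ys , D₁ , path ∷ va₁ , eq₁
      with Unique-↭ (same-verts eq₁) D-unique | ∈-++⁻ (suc u ∷ ys) (∈-resp-↭ (same-verts eq₁) (D-complete w))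
    ... | uq₁ | inj₁ (here refl) = ⊥-elim (u≢w refl)
    ... | uq₁ | inj₁ (there w∈) =
      close ys va₁ eq₁ (end-final (Unique-++ˡ (suc u ∷ ys) uq₁) w∈
        (λ j k → D-one ew (back eq₁ (Joined-++⁺ˡ j)) (back eq₁ (Joined-++⁺ˡ k))))
    ... | uq₁ | inj₂ w∈
      with extract va₁ (Unique-++ʳ (suc u ∷ ys) uq₁) w∈
             (λ j k → D-one ew (back eq₁ (Joined-++⁺ʳ (links (suc u ∷ ys)) j))
                               (back eq₁ (Joined-++⁺ʳ (links (suc u ∷ ys)) k)))
    ... | zs , D₂ , path ∷ va₂ , eq₂ = splice ys zs va₂ eq₁ eq₂

  decomposition : Decomposition G
  decomposition with Fin.any? (λ u → adj G zero (suc u) Bool.≟ true)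
  ... | no none = isolated (λ u e → none (u , e))
  ... | yes (u , eu) with Fin.any? (λ w → ¬? (u Fin.≟ w) ×-dec (adj G zero (suc w) Bool.≟ true))
  ...   | yes (w , u≢w , ew) = bridge u≢w eu ew
  ...   | no only = pendant eu (λ {v} ev → only-u v ev)
    where
    only-u : ∀ v → adj G zero (suc v) ≡ true → v ≡ u
    only-u v ev with u Fin.≟ v
    ... | yes e  = sym e
    ... | no u≢v = ⊥-elim (only (v , u≢v , ev))

decompose : ∀ {n} (G : Graph n) → NoThree G → Decomposition G
decompose {zero} G no3 = record
  { pieces = [] ; valid = [] ; distinct = [] ; spanning = λ ()
  ; adj⇒ = λ { {()} } ; ⇒adj = λ { (inj₁ ()) ; (inj₂ ()) } }
decompose {suc n} G no3 =
  -- In the pigeonhole form `NoThree` the degree bound passes to the smaller graph by restriction,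
  -- without counting.
  Extend.decomposition G no3 (decompose (delete₀ G) (λ a b c →
    Sum.map Fin.suc-injective (Sum.map Fin.suc-injective Fin.suc-injective) (no3 a b c)))

-- Sum labels of disjoint unions of paths and cycles

-- Vertices are identified with their labels: `L` lists all labels, those of isolates included, and
-- `E` the edges as pairs of labels. No graph occurs, so concrete systems can be checked by
-- computation.
record SumSystem (E : List (ℕ × ℕ)) (L : List ℕ) : Set where
  field
    unique   : Unique L
    positive : All (1 ≤_) L
    sound    : All (λ e → uncurry _+_ e ∈ L) E
    complete : ∀ {a b} → a ∈ L → b ∈ L → a ≢ b → a + b ∈ L → Joined E a b
open SumSystem public

SumSystem-↭ : ∀ {E L M} → L ↭ M → SumSystem E L → SumSystem E M
SumSystem-↭ {L = L} {M} σ S = record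
  { unique   = Unique-↭ σ (unique S)
  ; positive = All-resp-↭ σ (positive S)
  ; sound    = All.map (∈-resp-↭ σ) (sound S)
  ; complete = λ a∈ b∈ a≢b s∈ → complete S (pull a∈) (pull b∈) a≢b (pull s∈)
  }
  where
  pull : ∀ {a} → a ∈ M → a ∈ L
  pull = ∈-resp-↭ (↭-sym σ)

module _ where
  open DecMembership ℕ._≟_ using () renaming (_∈?_ to _∈ℕ?_)
  open DecMembership (Prod.≡-dec ℕ._≟_ ℕ._≟_) using () renaming (_∈?_ to _∈ₑ?_)

  sumSystem? : ∀ E L → Dec (SumSystem E L)
  sumSystem? E L = map′ to from
    (allPairs? (λ a b → ¬? (a ℕ.≟ b)) L ×-dec All.all? (1 ℕ.≤?_) L ×-dec
     All.all? (λ e → uncurry _+_ e ∈ℕ? L) E ×-dec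
     All.all? (λ a → All.all? (λ b → a ℕ.≟ b ⊎-dec ¬? ((a + b) ∈ℕ? L) ⊎-dec
                                     (a , b) ∈ₑ? E ⊎-dec (b , a) ∈ₑ? E) L) L)
    where
    Complete : Set
    Complete = All (λ a → All (λ b → a ≡ b ⊎ a + b ∉ L ⊎ Joined E a b) L) L
    to : Unique L × All (1 ≤_) L × All (λ e → uncurry _+_ e ∈ L) E × Complete → SumSystem E L
    to (u , p , s , c) = record
      { unique = u ; positive = p ; sound = s
      ; complete = λ a∈ b∈ a≢b s∈ →
          [ ⊥-elim ∘ a≢b , [ (λ s∉ → ⊥-elim (s∉ s∈)) , id ] ] (All.lookup (All.lookup c a∈) b∈) }
    from : SumSystem E L → Unique L × All (1 ≤_) L × All (λ e → uncurry _+_ e ∈ L) E × Complete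
    from S = unique S , positive S , sound S , All.tabulate (λ a∈ → All.tabulate (λ b∈ → decide a∈ b∈))
      where
      decide : ∀ {a b} → a ∈ L → b ∈ L → a ≡ b ⊎ a + b ∉ L ⊎ Joined E a b
      decide {a} {b} a∈ b∈ with a ℕ.≟ b | (a + b) ∈ℕ? L
      ... | yes e | _      = inj₁ e
      ... | no _  | no s∉  = inj₂ (inj₁ s∉)
      ... | no n  | yes s∈ = inj₂ (inj₂ (complete S a∈ b∈ n s∈))

-- A new label `c` can create edges as a sum, and `split` puts these into `F`, or as a summand,
-- which `grow` excludes; the sum c + b = c is excluded by positivity.
add-label : ∀ {E L F c} → SumSystem E L → 1 ≤ c → All (c ≢_) L → All (λ e → uncurry _+_ e ≡ c) F →
            (∀ {a b} → a ∈ L → b ∈ L → a ≢ b → a + b ≡ c → Joined F a b) →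
            (∀ {a b} → a ∈ L → b ∈ L → c + a ≢ b) →
            SumSystem (F ++ E) (c ∷ L)
add-label {E} {L} {F} {c} S 1≤c new sums split grow = record
  { unique   = new ∷ unique S
  ; positive = 1≤c ∷ positive S
  ; sound    = All.++⁺ (All.map here sums) (All.map there (sound S))
  ; complete = cases
  }
  where
  above : ∀ {b} → b ∈ L → c + b ∈ c ∷ L → ⊥
  above b∈ (here e)  = ℕ.m+1+n≢m c (≡.trans (cong (c +_) (proj₂ (pred b∈))) e)
    where
    pred : ∀ {b} → b ∈ L → ∃ λ k → suc k ≡ b
    pred {zero}  m with () ← All.lookup (positive S) m
    pred {suc k} _ = k , refl
  above b∈ (there m) = grow b∈ m refl
  cases : ∀ {a b} → a ∈ c ∷ L → b ∈ c ∷ L → a ≢ b → a + b ∈ c ∷ L → Joined (F ++ E) a b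
  cases (here refl) (here refl) a≢b _         = ⊥-elim (a≢b refl)
  cases (here refl) (there b∈)  a≢b s∈        = ⊥-elim (above b∈ s∈)
  cases {a} (there a∈) (here refl) a≢b s∈     = ⊥-elim (above a∈ (subst (_∈ c ∷ L) (ℕ.+-comm a c) s∈))
  cases (there a∈)  (there b∈)  a≢b (here e)  = Joined-++⁺ˡ (split a∈ b∈ a≢b e)
  cases (there a∈)  (there b∈)  a≢b (there m) = Joined-++⁺ʳ F (complete S a∈ b∈ a≢b m)

add-top-label : ∀ {E L F c} → SumSystem E L → 1 ≤ c → All (_< c) L → All (λ e → uncurry _+_ e ≡ c) F →
                (∀ {a b} → a ∈ L → b ∈ L → a ≢ b → a + b ≡ c → Joined F a b) →
                SumSystem (F ++ E) (c ∷ L)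
add-top-label {c = c} S 1≤c top sums split =
  add-label S 1≤c (All.map (λ l e → ℕ.<-irrefl (sym e) l) top) sums split
    (λ {a} _ b∈ e → ℕ.<-irrefl (sym e) (ℕ.<-≤-trans (All.lookup top b∈) (ℕ.m≤m+n c a)))

-- A pair without `r` sums to less than r + y, and a pair with `r` is determined by its sum.
two-largest : ∀ {r y K a b} → y < r → All (_≤ y) K → a ∈ r ∷ K → b ∈ r ∷ K → a ≢ b → a + b ≡ r + y →
              Joined ((r , y) ∷ []) a b
two-largest {r} y<r K≤ (here refl) b∈ a≢b e with ℕ.+-cancelˡ-≡ r _ _ e
... | refl = inj₁ (here refl)
two-largest {r} {a = a} y<r K≤ (there a∈) (here refl) a≢b e
  with ℕ.+-cancelˡ-≡ r _ _ (≡.trans (ℕ.+-comm r a) e)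
... | refl = inj₂ (here refl)
two-largest y<r K≤ (there a∈) (there b∈) a≢b e =
  ⊥-elim (ℕ.<-irrefl e (ℕ.+-mono-<-≤ (ℕ.≤-<-trans (All.lookup K≤ a∈) y<r) (All.lookup K≤ b∈)))

-- If `r` was an isolate, it now has the single neighbour `y`, and r + y is the isolate in its
-- place.
join-two-largest : ∀ {E r y K} → SumSystem E (r ∷ y ∷ K) → y < r → All (_< y) K →
                   SumSystem ((r , y) ∷ E) (r + y ∷ r ∷ y ∷ K)
join-two-largest {r = r} {y} S y<r K< with positive S
... | 1≤r ∷ 1≤y ∷ _ =
  add-top-label S (ℕ.≤-trans 1≤r (ℕ.m≤m+n r y))
    (r<r+y ∷ ℕ.<-trans y<r r<r+y ∷ All.map (λ l → ℕ.<-trans l (ℕ.<-trans y<r r<r+y)) K<)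
    (refl ∷ []) (two-largest y<r (ℕ.≤-refl ∷ All.map ℕ.<⇒≤ K<))
  where
  r<r+y : r < r + y
  r<r+y = ℕ.m<m+n r 1≤y

-- Growing paths and cycles from the isolates

record Single (D : List (Piece ℕ)) (r : ℕ) : Set where
  field
    system : SumSystem (allEdges D) (r ∷ allVerts D)
    top    : All (_< r) (allVerts D)

-- The condition q < 2p rules out p + p = q, which would break the closing of a triangle started at p and q.
record Pair (D : List (Piece ℕ)) (p q : ℕ) : Set where
  field
    system : SumSystem (allEdges D) (q ∷ p ∷ allVerts D)
    top    : All (_< p) (allVerts D)
    p<q    : p < q
    q<2p   : q < p + p

-- The unfinished path is listed from its latest label y back to its first one; r is the only isolate.
record Open (y y′ : ℕ) (zs : List ℕ) (D : List (Piece ℕ)) (r : ℕ) : Set where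
  field
    system : SumSystem (links (y ∷ y′ ∷ zs) ++ allEdges D) (r ∷ y ∷ y′ ∷ zs ++ allVerts D)
    r≡     : r ≡ y + y′
    top    : All (_< y) (y′ ∷ zs ++ allVerts D)

  1≤y′ : 1 ≤ y′
  1≤y′ with _ ∷ _ ∷ p ∷ _ ← positive system = p

  y<r : y < r
  y<r = subst (y <_) (sym r≡) (ℕ.m<m+n y 1≤y′)

extend : ∀ {y y′ zs D r} → Open y y′ zs D r → Open r y (y′ ∷ zs) D (r + y)
extend {y} {y′} {zs} {D} {r} O = record
  { system = join-two-largest system y<r top
  ; r≡     = refl
  ; top    = y<r ∷ All.map (λ l → ℕ.<-trans l y<r) top
  }
  where open Open O

Pair⇒Open : ∀ {D p q} → Pair D p q → Open q p [] D (q + p)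
Pair⇒Open P = record
  { system = join-two-largest system p<q top
  ; r≡     = refl
  ; top    = p<q ∷ All.map (λ l → ℕ.<-trans l p<q) top
  }
  where open Pair P

-- A path starts from two labels, but only the isolate `r` is at hand. The second one is 2r + 1: it
-- exceeds every sum of two labels, so it creates no edge by itself.
Single⇒Open : ∀ {D r} → Single D r → Open (suc (r + r)) r [] D (suc (r + r) + r)
Single⇒Open {D} {r} Q = record
  { system = join-two-largest
      (add-top-label {F = []} system (s≤s z≤n) (r<s ∷ All.map (λ l → ℕ.<-trans l r<s) top) [] no-edge) r<s top
  ; r≡     = refl
  ; top    = r<s ∷ All.map (λ l → ℕ.<-trans l r<s) top
  }
  where
  open Single Q
  r<s : r < suc (r + r)
  r<s = s≤s (ℕ.m≤m+n r r)
  bound : All (_≤ r) (r ∷ allVerts D)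
  bound = ℕ.≤-refl ∷ All.map ℕ.<⇒≤ top
  no-edge : ∀ {a b} → a ∈ r ∷ allVerts D → b ∈ r ∷ allVerts D → a ≢ b → a + b ≡ suc (r + r) → Joined [] a b
  no-edge a∈ b∈ _ e = ⊥-elim (ℕ.<-irrefl e (s≤s (ℕ.+-mono-≤ (All.lookup bound a∈) (All.lookup bound b∈))))

Open⇒Single : ∀ {y y′ zs D r} → Open y y′ zs D r → Single (path (y ∷ y′ ∷ zs) ∷ D) r
Open⇒Single O = record { system = system ; top = y<r ∷ All.map (λ l → ℕ.<-trans l y<r) top }
  where open Open O

-- Let f be the first label and c = f + y the isolate made by closing. By `first<`, c lies below r.
-- By `small`, two labels other than r and y sum to at most y < c, so no unwanted pair sums to c. As
-- r - c = y′ - f, `no-gap` says that c is not joined to any label.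
record Closable (y y′ : ℕ) (zs : List ℕ) (D : List (Piece ℕ)) (r : ℕ) : Set where
  field
    isOpen : Open y y′ zs D r
    first< : final y′ zs < y′
    small  : All (λ b → b < y′ × y′ + b ≤ y) (zs ++ allVerts D)
    no-gap : ∀ {a} → a ∈ r ∷ y ∷ y′ ∷ zs ++ allVerts D → final y′ zs + a ≢ y′

close : ∀ {y y′ zs D r} → Closable y y′ zs D r → Pair (cycle (y ∷ y′ ∷ zs) ∷ D) (final y′ zs + y) r
close {y} {y′} {zs} {D} {r} K = record
  { system = SumSystem-↭ (swap c r ↭-refl)
      (add-label {F = (f , y) ∷ []} system (ℕ.≤-trans 1≤f (ℕ.m≤m+n f y))
        ((λ e → ℕ.<-irrefl e c<r) ∷ All.map (λ l e → ℕ.<-irrefl (sym e) l) below-c)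
        (refl ∷ []) pairs grow)
  ; top    = below-c
  ; p<q    = c<r
  ; q<2p   = subst (_< c + c) (sym r≡) (ℕ.+-mono-< y<c (ℕ.<-trans (All.head top) y<c))
  }
  where
  open Closable K
  open Open isOpen
  f c : ℕ
  f = final y′ zs
  c = f + y
  f∈ : f ∈ y′ ∷ zs ++ allVerts D
  f∈ = ∈-++⁺ˡ (final-∈ y′ zs)
  1≤f : 1 ≤ f
  1≤f = All.lookup (positive system) (there (there f∈))
  y<c : y < c
  y<c = ℕ.m<n+m y 1≤f
  c<r : c < r
  c<r = subst (c <_) (≡.trans (ℕ.+-comm y′ y) (sym r≡)) (ℕ.+-monoˡ-< y first<)
  below-c : All (_< c) (y ∷ y′ ∷ zs ++ allVerts D)
  below-c = y<c ∷ All.map (λ l → ℕ.<-trans l y<c) top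
  rest-≤ : ∀ {a b} → a ∈ y′ ∷ zs ++ allVerts D → b ∈ y′ ∷ zs ++ allVerts D → a ≢ b → a + b ≤ y
  rest-≤ (here refl) (here refl) a≢b = ⊥-elim (a≢b refl)
  rest-≤ (here refl) (there b∈)  a≢b = proj₂ (All.lookup small b∈)
  rest-≤ {a} (there a∈) (here refl) a≢b = subst (_≤ y) (ℕ.+-comm y′ a) (proj₂ (All.lookup small a∈))
  rest-≤ {a} {b} (there a∈) (there b∈) a≢b =
    ℕ.≤-trans (ℕ.+-monoˡ-≤ b (ℕ.<⇒≤ (proj₁ (All.lookup small a∈)))) (proj₂ (All.lookup small b∈))
  pairs : ∀ {a b} → a ∈ r ∷ y ∷ y′ ∷ zs ++ allVerts D → b ∈ r ∷ y ∷ y′ ∷ zs ++ allVerts D →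
          a ≢ b → a + b ≡ c → Joined ((f , y) ∷ []) a b
  pairs {b = b} (here refl) b∈ _ e = ⊥-elim (ℕ.<-irrefl (sym e) (ℕ.<-≤-trans c<r (ℕ.m≤m+n r b)))
  pairs {a} (there _) (here refl) _ e = ⊥-elim (ℕ.<-irrefl (sym e) (ℕ.<-≤-trans c<r (ℕ.m≤n+m r a)))
  pairs {b = b} (there (here refl)) (there _) _ e
    with refl ← ℕ.+-cancelˡ-≡ y b f (≡.trans e (ℕ.+-comm f y)) = inj₂ (here refl)
  pairs {a} (there (there _)) (there (here refl)) _ e
    with refl ← ℕ.+-cancelʳ-≡ y a f e = inj₁ (here refl)
  pairs (there (there a∈)) (there (there b∈)) a≢b e =
    ⊥-elim (ℕ.<-irrefl e (ℕ.≤-<-trans (rest-≤ a∈ b∈ a≢b) y<c))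
  grow : ∀ {a b} → a ∈ r ∷ y ∷ y′ ∷ zs ++ allVerts D → b ∈ r ∷ y ∷ y′ ∷ zs ++ allVerts D → c + a ≢ b
  grow {a} a∈ (there b∈) e = ℕ.<-irrefl (sym e) (ℕ.<-≤-trans (All.lookup below-c b∈) (ℕ.m≤m+n c a))
  grow {a} a∈ (here refl) e = no-gap a∈ (ℕ.+-cancelˡ-≡ y _ _ (begin
    y + (f + a) ≡⟨ ℕ.+-assoc y f a ⟨
    y + f + a   ≡⟨ cong (_+ a) (ℕ.+-comm y f) ⟩
    c + a       ≡⟨ e ⟩
    r           ≡⟨ r≡ ⟩
    y + y′      ∎))
    where open ≡.≡-Reasoning

-- With f = p and y′ = q, `no-gap` becomes p + a ≢ q. The case a = p is what `q<2p` excludes, and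
-- larger labels of the new cycle overshoot.
triangle : ∀ {D p q} → Pair D p q → ∃₂ λ p′ q′ → Pair (cycle (q + p ∷ q ∷ p ∷ []) ∷ D) p′ q′
triangle {D} {p} {q} P = _ , _ , close record
  { isOpen = extend (Pair⇒Open P)
  ; first< = p<q
  ; small  = (p<q , ℕ.≤-refl) ∷ All.map (λ l → ℕ.<-trans l p<q , ℕ.+-monoʳ-≤ q (ℕ.<⇒≤ l)) top
  ; no-gap = gap
  }
  where
  open Pair P
  beyond : ∀ {a} → q ≤ a → p + a ≢ q
  beyond q≤a e = ℕ.<-irrefl (sym e) (ℕ.≤-<-trans q≤a (ℕ.m<n+m _ (All.lookup (positive system) (there (here refl)))))
  gap : ∀ {a} → a ∈ (q + p) + q ∷ q + p ∷ q ∷ p ∷ allVerts D → p + a ≢ q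
  gap (here refl)                         = beyond (ℕ.m≤n+m q (q + p))
  gap (there (here refl))                 = beyond (ℕ.m≤m+n q p)
  gap (there (there (here refl)))         = beyond ℕ.≤-refl
  gap (there (there (there (here refl)))) e = ℕ.<-irrefl (sym e) q<2p
  -- For an old vertex label `a`, the equation p + a = q would have given the isolate `p` an edge
  -- before the triangle was added.
  gap (there (there (there (there a∈)))) e
    with complete system (there (here refl)) (there (there a∈))
           (λ p≡a → ℕ.<-irrefl (sym p≡a) (All.lookup top a∈)) (here e)
  ... | j = ℕ.<-irrefl refl (All.lookup top (Joined-∈ D j))

-- From the fifth label of a chain on, the first label is too small to bridge two of the later ones.
record Chain (y y′ y″ : ℕ) (zs : List ℕ) (D : List (Piece ℕ)) (r : ℕ) : Set where
  field
    isOpen : Open y y′ (y″ ∷ zs) D r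
    y≡     : y ≡ y′ + y″
    gap<   : final y″ zs + y″ < y′
    first< : final y″ zs < y″
    small  : All (_≤ y″) (zs ++ allVerts D)

extend-chain : ∀ {y y′ y″ zs D r} → Chain y y′ y″ zs D r → Chain r y y′ (y″ ∷ zs) D (r + y)
extend-chain {y} {y′} {y″} {zs} K = record
  { isOpen = extend isOpen
  ; y≡     = r≡
  -- As y = y′ + y″, the inequality f + y′ < y reduces to f < y″.
  ; gap<   = subst (final y″ zs + y′ <_) (≡.trans (ℕ.+-comm y″ y′) (sym y≡)) (ℕ.+-monoˡ-< y′ first<)
  ; first< = ℕ.<-trans first< y″<y′
  ; small  = ℕ.<⇒≤ y″<y′ ∷ All.map (λ l → ℕ.≤-trans l (ℕ.<⇒≤ y″<y′)) small
  }
  where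
  open Chain K
  open Open isOpen using (r≡)
  y″<y′ : y″ < y′
  y″<y′ = ℕ.≤-<-trans (ℕ.m≤n+m y″ (final y″ zs)) gap<

close-chain : ∀ {y y′ y″ zs D r} → Chain y y′ y″ zs D r →
              Pair (cycle (y ∷ y′ ∷ y″ ∷ zs) ∷ D) (final y″ zs + y) r
close-chain {y} {y′} {y″} {zs} {D} {r} K = close record
  { isOpen = isOpen
  ; first< = ℕ.<-trans first< y″<y′
  ; small  = All.map (λ l → ℕ.≤-<-trans l y″<y′ , subst (_ ≤_) (sym y≡) (ℕ.+-monoʳ-≤ y′ l)) small′
  ; no-gap = no-gap
  }
  where
  open Chain K
  open Open isOpen
  y″<y′ : y″ < y′
  y″<y′ = ℕ.≤-<-trans (ℕ.m≤n+m y″ (final y″ zs)) gap<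
  small′ : All (_≤ y″) (y″ ∷ zs ++ allVerts D)
  small′ = ℕ.≤-refl ∷ small
  1≤f : 1 ≤ final y″ zs
  1≤f = All.lookup (positive system) (there (there (there (∈-++⁺ˡ (final-∈ y″ zs)))))
  beyond : ∀ {a} → y′ ≤ a → final y″ zs + a ≢ y′
  beyond y′≤a e = ℕ.<-irrefl (sym e) (ℕ.≤-<-trans y′≤a (ℕ.m<n+m _ 1≤f))
  y′≤y : y′ ≤ y
  y′≤y = ℕ.<⇒≤ (All.head top)
  no-gap : ∀ {a} → a ∈ r ∷ y ∷ y′ ∷ (y″ ∷ zs) ++ allVerts D → final y″ zs + a ≢ y′
  no-gap (here refl)                 = beyond (ℕ.≤-trans y′≤y (ℕ.<⇒≤ y<r))
  no-gap (there (here refl))         = beyond y′≤y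
  no-gap (there (there (here refl))) = beyond ℕ.≤-refl
  no-gap (there (there (there a∈))) e =
    ℕ.<-irrefl e (ℕ.≤-<-trans (ℕ.+-monoʳ-≤ _ (All.lookup small′ a∈)) gap<)

Pair⇒Chain : ∀ {D p q} → Pair D p q →
             Chain (q + p + q + (q + p)) (q + p + q) (q + p) (q ∷ p ∷ []) D (q + p + q + (q + p) + (q + p + q))
Pair⇒Chain {D} {p} {q} P = record
  { isOpen = extend (extend (extend (Pair⇒Open P)))
  ; y≡     = refl
  ; gap<   = subst (_< q + p + q) (ℕ.+-comm (q + p) p) (ℕ.+-monoʳ-< (q + p) p<q)
  ; first< = ℕ.m<n+m p (ℕ.≤-<-trans z≤n p<q)
  ; small  = ℕ.m≤m+n q p ∷ ℕ.m≤n+m p q ∷ All.map (λ l → ℕ.≤-trans (ℕ.<⇒≤ l) (ℕ.m≤n+m p q)) top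
  }
  where open Pair P

-- Appending two copies of C₄

-- The form (α , β) stands for α u + β v, where u and v are positive, u is odd and v is even.
Form : Set
Form = ℕ × ℕ

_⊹_ : Form → Form → Form
(α , β) ⊹ (α′ , β′) = α + α′ , β + β′

-- Comparing coefficients is uniform in `u` and `v` and decidable on numerals. `_≺_` is strict in
-- the first coefficient because an odd `u` cannot vanish.
_≼_ _≺_ : Form → Form → Set
(α , β) ≼ (α′ , β′) = α ≤ α′ × β ≤ β′
(α , β) ≺ (α′ , β′) = α < α′ × β ≤ β′

_≼?_ : ∀ f g → Dec (f ≼ g)
(α , β) ≼? (α′ , β′) = α ℕ.≤? α′ ×-dec β ℕ.≤? β′

_≺?_ : ∀ f g → Dec (f ≺ g)
(α , β) ≺? (α′ , β′) = α ℕ.<? α′ ×-dec β ℕ.≤? β′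

_≟ᶠ_ : (f g : Form) → Dec (f ≡ g)
_≟ᶠ_ = Prod.≡-dec ℕ._≟_ ℕ._≟_

-- With x = (5 , 1) and y = (16 , 3), the isolates 2p and 2q of the doubled system are 2x and y;
-- the cycles are 2x, x + 2y, 3x + y, y and 4x + 3y, x, 2x + y, 3x + 2y,
-- and the new isolates are 5x + 3y and 7x + 5y.
fP fQ fP′ fQ′ : Form
fP  = 10 , 2
fQ  = 16 , 3
fP′ = 73 , 14
fQ′ = 115 , 22

squareA squareB : Piece Form
squareA = cycle (fP ∷ (37 , 7) ∷ (31 , 6) ∷ fQ ∷ [])
squareB = cycle ((68 , 13) ∷ (5 , 1) ∷ (26 , 5) ∷ (47 , 9) ∷ [])

formVerts forms : List Form
formVerts = allVerts (squareA ∷ squareB ∷ [])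
forms     = fQ′ ∷ fP′ ∷ formVerts

formEdges : List (Form × Form)
formEdges = allEdges (squareA ∷ squareB ∷ [])

-- As `u` is odd and `v` is even, α u + β v has the parity of α.
OddDifference : Form → Form → Set
OddDifference (α , _) (α′ , _) = α % 2 ≢ α′ % 2

oddDifference? : ∀ f g → Dec (OddDifference f g)
oddDifference? (α , _) (α′ , _) = ¬? (α % 2 ℕ.≟ α′ % 2)

module _ where
  open DecMembership _≟ᶠ_ using (_∈?_)
  open DecMembership (Prod.≡-dec _≟ᶠ_ _≟ᶠ_) using () renaming (_∈?_ to _∈ₑ?_)

  abstract
    forms-distinct : AllPairs (λ f g → f ≺ g ⊎ g ≺ f) forms
    forms-distinct = from-yes (allPairs? (λ f g → f ≺? g ⊎-dec g ≺? f) forms)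

    forms-positive : All ((1 , 0) ≼_) forms
    forms-positive = from-yes (All.all? ((1 , 0) ≼?_) forms)

    forms-sound : All (λ e → uncurry _⊹_ e ∈ forms) formEdges
    forms-sound = from-yes (All.all? (λ e → uncurry _⊹_ e ∈? forms) formEdges)

    -- Only x = (5 , 1) fails to dominate `fP`, and it is odd, whereas the doubled old labels are
    -- even.
    forms-not-old : All (λ f → OddDifference f (0 , 0) ⊎ fP ≼ f) forms
    forms-not-old = from-yes (All.all? (λ f → oddDifference? f (0 , 0) ⊎-dec fP ≼? f) forms)

    new+new : All (λ f → All (λ g → f ≡ g ⊎ Joined formEdges f g ⊎
                                    fP ≼ (f ⊹ g) × All (λ h → (f ⊹ g) ≺ h ⊎ h ≺ (f ⊹ g)) forms) forms) forms
    new+new = from-yes (All.all? (λ f → All.all? (λ g →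
      f ≟ᶠ g ⊎-dec ((f , g) ∈ₑ? formEdges ⊎-dec (g , f) ∈ₑ? formEdges) ⊎-dec
      fP ≼? (f ⊹ g) ×-dec All.all? (λ h → (f ⊹ g) ≺? h ⊎-dec h ≺? (f ⊹ g)) forms) forms) forms)

    -- A doubled old label is even and lies strictly between 0 and the value of `fP`. Hence it can
    -- be a difference of two forms only in the last case, where (6 , 1) is the difference of `fQ`
    -- and `fP`; `gap-contradiction` rules that out.
    old+new : All (λ f → All (λ h → h ≼ f ⊎ OddDifference f h ⊎ (f ⊹ fP) ≼ h ⊎ h ≡ f ⊹ (6 , 1)) forms) forms
    old+new = from-yes (All.all? (λ f → All.all? (λ h →
      h ≼? f ⊎-dec oddDifference? f h ⊎-dec (f ⊹ fP) ≼? h ⊎-dec h ≟ᶠ (f ⊹ (6 , 1))) forms) forms)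

    old+old : All (λ h → OddDifference (0 , 0) h ⊎ h ≡ fP ⊎ h ≡ fQ ⊎ (fP ⊹ fP) ≼ h) forms
    old+old = from-yes (All.all? (λ h →
      oddDifference? (0 , 0) h ⊎-dec h ≟ᶠ fP ⊎-dec h ≟ᶠ fQ ⊎-dec (fP ⊹ fP) ≼? h) forms)

    forms-top : All (_≺ fP′) formVerts
    forms-top = from-yes (All.all? (_≺? fP′) formVerts)

-- Solving the two equations gives u = 2q - 3p and v = 16p - 10q. So the conditions amount to: p is
-- odd, 3p < 2q and 5q ≤ 8p. The coordinates u and v turn this range of q/p into nonnegative
-- coefficients, so that labels can be compared coefficient by coefficient.
record OddPair (D : List (Piece ℕ)) : Set where
  field
    {p q} u v k w : ℕ
    isPair : Pair D p q
    u-odd  : u ≡ 1 + k * 2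
    v-even : v ≡ w * 2
    p*2≡   : p * 2 ≡ u * 10 + v * 2
    q*2≡   : q * 2 ≡ u * 16 + v * 3

-- Doubling the old labels makes room for the odd label x, half of the isolate 2p: every difference of two
-- new labels is then odd, at least 2p, or equal to 2q - 2p.
module TwoSquares {D} (O : OddPair D) where
  open OddPair O
  open Pair isPair

  opaque
    eval : Form → ℕ
    eval (α , β) = u * α + v * β

    eval≡ : ∀ α β → eval (α , β) ≡ u * α + v * β
    eval≡ α β = refl

    eval-⊹ : ∀ f g → eval (f ⊹ g) ≡ eval f + eval g
    eval-⊹ (α , β) (α′ , β′) = identity α β α′ β′ u v
      where
      identity : ∀ α β α′ β′ u v → u * (α + α′) + v * (β + β′) ≡ (u * α + v * β) + (u * α′ + v * β′)
      identity = solve-∀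

    eval-≼ : ∀ {f g} → f ≼ g → eval f ≤ eval g
    eval-≼ (a , b) = ℕ.+-mono-≤ (ℕ.*-monoʳ-≤ u a) (ℕ.*-monoʳ-≤ v b)

    eval-≺ : ∀ {f g} → f ≺ g → eval f < eval g
    eval-≺ {α , β} {α′ , β′} (a , b) =
      ℕ.+-mono-<-≤ (subst (λ n → n * α < n * α′) (sym u-odd) (ℕ.*-monoʳ-< (1 + k * 2) a)) (ℕ.*-monoʳ-≤ v b)

    parity : ∀ α β a → (a * 2 + eval (α , β)) % 2 ≡ α % 2
    parity α β a rewrite u-odd | v-even =
      ≡.trans (cong (_% 2) (identity α β a k w)) ([m+kn]%n≡m%n α (a + k * α + w * β) 2)
      where
      identity : ∀ α β a k w → a * 2 + ((1 + k * 2) * α + (w * 2) * β) ≡ α + (a + k * α + w * β) * 2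
      identity = solve-∀

  eval-≢ : ∀ {f g} → f ≺ g ⊎ g ≺ f → eval f ≢ eval g
  eval-≢ (inj₁ l) e = ℕ.<-irrefl e (eval-≺ l)
  eval-≢ (inj₂ l) e = ℕ.<-irrefl (sym e) (eval-≺ l)

  1≤eval : ∀ {f} → (1 , 0) ≼ f → 1 ≤ eval f
  1≤eval l = ℕ.≤-<-trans z≤n (ℕ.<-≤-trans (eval-≺ {0 , 0} {1 , 0} (s≤s z≤n , z≤n)) (eval-≼ l))

  odd-difference : ∀ f h {a b} → OddDifference f h → a * 2 + eval f ≢ b * 2 + eval h
  odd-difference (α , β) (α′ , β′) {a} {b} o e =
    o (≡.trans (sym (parity α β a)) (≡.trans (cong (_% 2) e) (parity α′ β′ b)))

  eval-0 : eval (0 , 0) ≡ 0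
  eval-0 = ≡.trans (eval≡ 0 0) (cong₂ _+_ (ℕ.*-zeroʳ u) (ℕ.*-zeroʳ v))

  eval-P : eval fP ≡ p * 2
  eval-P = ≡.trans (eval≡ 10 2) (sym p*2≡)

  eval-Q : eval fQ ≡ q * 2
  eval-Q = ≡.trans (eval≡ 16 3) (sym q*2≡)

  eval-gap : eval (6 , 1) + p * 2 ≡ q * 2
  eval-gap = ≡.trans (cong (eval (6 , 1) +_) (sym eval-P)) (≡.trans (sym (eval-⊹ (6 , 1) fP)) eval-Q)

  old : List ℕ
  old = map (_* 2) (allVerts D)

  old-∈ : ∀ {a} → a ∈ old → ∃ λ b → b ∈ allVerts D × a ≡ b * 2
  old-∈ = ∈-map⁻ (_* 2)

  old<P : ∀ {b} → b ∈ allVerts D → b * 2 < eval fP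
  old<P b∈ = subst (_ <_) (sym eval-P) (ℕ.*-monoˡ-< 2 (All.lookup top b∈))

  old+0 : ∀ b → b * 2 ≡ b * 2 + eval (0 , 0)
  old+0 b = sym (≡.trans (cong (b * 2 +_) eval-0) (ℕ.+-identityʳ (b * 2)))

  old≢new : ∀ {b f} → b ∈ allVerts D → f ∈ forms → b * 2 ≢ eval f
  old≢new {b} {f} b∈ f∈ e with All.lookup forms-not-old f∈
  ... | inj₁ o = odd-difference f (0 , 0) {0} {b} o (≡.trans (sym e) (old+0 b))
  ... | inj₂ l = ℕ.<-irrefl e (ℕ.<-≤-trans (old<P b∈) (eval-≼ l))

  1≤old*2 : ∀ {b} → b ∈ allVerts D → 1 ≤ b * 2
  1≤old*2 {b} b∈ = ℕ.≤-trans (All.lookup (positive system) (there (there b∈))) (ℕ.m≤m*n b 2)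

  D′ : List (Piece ℕ)
  D′ = mapPiece eval squareA ∷ mapPiece eval squareB ∷ map (mapPiece (_* 2)) D

  doubleₑ : ℕ × ℕ → ℕ × ℕ
  doubleₑ = Prod.map (_* 2) (_* 2)

  labels : List ℕ
  labels = map eval forms ++ old

  E : List (ℕ × ℕ)
  E = map (Prod.map eval eval) formEdges ++ map doubleₑ (allEdges D)

  -- Otherwise the old system would have an edge at its isolate `p`.
  gap-contradiction : ∀ {b} → b ∈ allVerts D → p + b ≢ q
  gap-contradiction {b} b∈ e
    with complete system (there (here refl)) (there (there b∈))
           (λ p≡b → ℕ.<-irrefl (sym p≡b) (All.lookup top b∈)) (here e)
  ... | j = ℕ.<-irrefl refl (All.lookup top (Joined-∈ D j))

  new+new-case : ∀ {f g} → f ∈ forms → g ∈ forms → eval f ≢ eval g → eval f + eval g ∈ labels →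
                 Joined E (eval f) (eval g)
  new+new-case {f} {g} f∈ g∈ ne s∈ with All.lookup (All.lookup new+new f∈) g∈
  ... | inj₁ refl     = ⊥-elim (ne refl)
  ... | inj₂ (inj₁ j) = Joined-++⁺ˡ (Joined-map⁺ eval j)
  ... | inj₂ (inj₂ (l , sep)) with ∈-++⁻ (map eval forms) s∈
  ...   | inj₁ m with ∈-map⁻ eval m
  ...     | h , h∈ , e = ⊥-elim (eval-≢ (All.lookup sep h∈) (≡.trans (eval-⊹ f g) e))
  new+new-case {f} {g} f∈ g∈ ne s∈ | inj₂ (inj₂ (l , sep)) | inj₂ m with old-∈ m
  ...     | b , b∈ , e =
    ⊥-elim (ℕ.<-irrefl (≡.trans (sym e) (sym (eval-⊹ f g))) (ℕ.<-≤-trans (old<P b∈) (eval-≼ l)))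

  old+new-case : ∀ {b f} → b ∈ allVerts D → f ∈ forms → b * 2 + eval f ∉ labels
  old+new-case {b} {f} b∈ f∈ s∈ with ∈-++⁻ (map eval forms) s∈
  ... | inj₁ m with ∈-map⁻ eval m
  ...   | h , h∈ , e with All.lookup (All.lookup old+new f∈) h∈
  ...     | inj₁ l = ℕ.<-irrefl (sym e) (ℕ.≤-<-trans (eval-≼ l) (ℕ.m<n+m (eval f) (1≤old*2 b∈)))
  ...     | inj₂ (inj₁ o) = odd-difference f h {b} {0} o e
  ...     | inj₂ (inj₂ (inj₁ l)) = ℕ.<-irrefl e (ℕ.<-≤-trans
    (subst (b * 2 + eval f <_) (≡.trans (ℕ.+-comm (eval fP) (eval f)) (sym (eval-⊹ f fP)))
      (ℕ.+-monoˡ-< (eval f) (old<P b∈))) (eval-≼ l))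
  ...     | inj₂ (inj₂ (inj₂ refl)) = gap-contradiction b∈ (ℕ.*-cancelʳ-≡ (p + b) q 2 (begin
    (p + b) * 2           ≡⟨ ℕ.*-distribʳ-+ 2 p b ⟩
    p * 2 + b * 2         ≡⟨ cong (p * 2 +_) (ℕ.+-cancelʳ-≡ (eval f) _ _
                               (≡.trans e (≡.trans (eval-⊹ f (6 , 1)) (ℕ.+-comm (eval f) _)))) ⟩
    p * 2 + eval (6 , 1)  ≡⟨ ℕ.+-comm (p * 2) _ ⟩
    eval (6 , 1) + p * 2  ≡⟨ eval-gap ⟩
    q * 2                 ∎))
    where open ≡.≡-Reasoning
  old+new-case {b} {f} b∈ f∈ s∈ | inj₂ m with old-∈ m
  ... | c , c∈ , e with All.lookup forms-not-old f∈
  ...   | inj₁ o = odd-difference f (0 , 0) {b} {c} o (≡.trans e (old+0 c))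
  ...   | inj₂ l = ℕ.<-irrefl (sym e) (ℕ.<-≤-trans (old<P c∈) (ℕ.≤-trans (eval-≼ l) (ℕ.m≤n+m (eval f) (b * 2))))

  old+old-case : ∀ {a b} → a ∈ allVerts D → b ∈ allVerts D → a ≢ b → a * 2 + b * 2 ∈ labels →
                 Joined (allEdges D) a b
  old+old-case {a} {b} a∈ b∈ ne s∈ with ∈-++⁻ (map eval forms) s∈
  ... | inj₂ m with old-∈ m
  ...   | c , c∈ , e =
    complete system (there (there a∈)) (there (there b∈)) ne (there (there (subst (_∈ allVerts D) (sym half) c∈)))
    where
    half : a + b ≡ c
    half = ℕ.*-cancelʳ-≡ (a + b) c 2 (≡.trans (ℕ.*-distribʳ-+ 2 a b) e)
  old+old-case {a} {b} a∈ b∈ ne s∈ | inj₁ m with ∈-map⁻ eval m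
  ... | h , h∈ , e = cases (All.lookup old+old h∈)
    where
    e′ : (a + b) * 2 ≡ eval h
    e′ = ≡.trans (ℕ.*-distribʳ-+ 2 a b) e
    joined : a + b ∈ q ∷ p ∷ allVerts D → Joined (allEdges D) a b
    joined = complete system (there (there a∈)) (there (there b∈)) ne
    cases : OddDifference (0 , 0) h ⊎ h ≡ fP ⊎ h ≡ fQ ⊎ (fP ⊹ fP) ≼ h → Joined (allEdges D) a b
    cases (inj₁ o) =
      ⊥-elim (odd-difference (0 , 0) h {a + b} {0} o (≡.trans (sym (old+0 (a + b))) e′))
    cases (inj₂ (inj₁ refl)) = joined (there (here (ℕ.*-cancelʳ-≡ (a + b) p 2 (≡.trans e′ eval-P))))
    cases (inj₂ (inj₂ (inj₁ refl))) = joined (here (ℕ.*-cancelʳ-≡ (a + b) q 2 (≡.trans e′ eval-Q)))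
    cases (inj₂ (inj₂ (inj₂ l))) = ⊥-elim (ℕ.<-irrefl e (ℕ.<-≤-trans
      (ℕ.+-mono-< (old<P a∈) (old<P b∈)) (subst (_≤ eval h) (eval-⊹ fP fP) (eval-≼ l))))

  system′ : SumSystem E labels
  system′ = record
    { unique   = Unique.++⁺ (AllPairs.map⁺ (AllPairs.map eval-≢ forms-distinct))
                   (Unique.map⁺ (ℕ.*-cancelʳ-≡ _ _ 2) (AllPairs.tail (AllPairs.tail (unique system))))
                   disjoint
    ; positive = All.++⁺ (All.map⁺ (All.map 1≤eval forms-positive))
                   (All.map⁺ (All.tabulate 1≤old*2))
    ; sound    = All.++⁺ new-sound old-sound
    ; complete = cases
    }
    where
    disjoint : ∀ {a} → a ∈ map eval forms × a ∈ old → ⊥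
    disjoint (m , n) with ∈-map⁻ eval m | old-∈ n
    ... | f , f∈ , refl | b , b∈ , e = old≢new b∈ f∈ (sym e)
    Sound : ℕ × ℕ → Set
    Sound e = uncurry _+_ e ∈ labels
    new-sound : All Sound (map (Prod.map eval eval) formEdges)
    new-sound = All.map⁺ {P = Sound} {f = Prod.map eval eval} (All.map (λ { {f , g} m →
      ∈-++⁺ˡ (subst (_∈ map eval forms) (eval-⊹ f g) (∈-map⁺ eval m)) }) forms-sound)
    old-sound : All Sound (map doubleₑ (allEdges D))
    old-sound = All.map⁺ {P = Sound} {f = doubleₑ} (All.map (λ { {a , b} m →
      subst (_∈ labels) (ℕ.*-distribʳ-+ 2 a b) (doubled m) }) (sound system))
      where
      fP∈ : fP ∈ forms
      fP∈ = there (there (here refl))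
      fQ∈ : fQ ∈ forms
      fQ∈ = there (there (there (there (there (here refl)))))
      doubled : ∀ {c} → c ∈ q ∷ p ∷ allVerts D → c * 2 ∈ labels
      doubled (here refl)         = ∈-++⁺ˡ (subst (_∈ map eval forms) eval-Q (∈-map⁺ eval fQ∈))
      doubled (there (here refl)) = ∈-++⁺ˡ (subst (_∈ map eval forms) eval-P (∈-map⁺ eval fP∈))
      doubled (there (there c∈))  = ∈-++⁺ʳ (map eval forms) (∈-map⁺ (_* 2) c∈)
    cases : ∀ {a b} → a ∈ labels → b ∈ labels → a ≢ b → a + b ∈ labels → Joined E a b
    cases {a} {b} a∈ b∈ ne s∈ with ∈-++⁻ (map eval forms) a∈ | ∈-++⁻ (map eval forms) b∈
    ... | inj₁ m | inj₁ n with ∈-map⁻ eval m | ∈-map⁻ eval n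
    ...   | f , f∈ , refl | g , g∈ , refl = new+new-case f∈ g∈ ne s∈
    cases {a} {b} a∈ b∈ ne s∈ | inj₁ m | inj₂ n with ∈-map⁻ eval m | old-∈ n
    ...   | f , f∈ , refl | c , c∈ , refl =
      ⊥-elim (old+new-case c∈ f∈ (subst (_∈ labels) (ℕ.+-comm (eval f) (c * 2)) s∈))
    cases {a} {b} a∈ b∈ ne s∈ | inj₂ m | inj₁ n with old-∈ m | ∈-map⁻ eval n
    ...   | c , c∈ , refl | f , f∈ , refl = ⊥-elim (old+new-case c∈ f∈ s∈)
    cases {a} {b} a∈ b∈ ne s∈ | inj₂ m | inj₂ n with old-∈ m | old-∈ n
    ...   | c , c∈ , refl | d , d∈ , refl =
      Joined-++⁺ʳ (map (Prod.map eval eval) formEdges)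
        (Joined-map⁺ (_* 2) (old+old-case c∈ d∈ (λ e → ne (cong (_* 2) e)) s∈))

  result : OddPair D′
  result = record
    -- These are 2q′ - 3p′ and 16p′ - 10q′ for the new isolates p′ = 73u + 14v and q′ = 115u + 22v.
    -- The new `u` is odd again, so the step can be iterated.
    { u = u * 11 + v * 2 ; v = u * 18 + v * 4 ; k = 5 + k * 11 + v ; w = u * 9 + v * 2
    ; isPair = record
      { system = subst₂ (λ F V → SumSystem (map (Prod.map eval eval) formEdges ++ F) (map eval forms ++ V))
                   (sym (allEdges-map (_* 2) D)) (sym (allVerts-map (_* 2) D)) system′
      ; top    = subst (λ V → All (_< eval fP′) (map eval formVerts ++ V)) (sym (allVerts-map (_* 2) D))
                   (All.++⁺ (All.map⁺ (All.map eval-≺ forms-top))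
                     (All.map⁺ (All.tabulate λ b∈ → ℕ.<-≤-trans (old<P b∈)
                       (eval-≼ {fP} {fP′} (ℕ.m≤m+n 10 63 , ℕ.m≤m+n 2 12)))))
      ; p<q    = eval-≺ {fP′} {fQ′} (ℕ.m≤m+n 74 41 , ℕ.m≤m+n 14 8)
      ; q<2p   = subst (eval fQ′ <_) (eval-⊹ fP′ fP′)
                   (eval-≺ {fQ′} {fP′ ⊹ fP′} (ℕ.m≤m+n 116 30 , ℕ.m≤m+n 22 6))
      }
    ; u-odd  = ≡.trans (cong (λ n → n * 11 + v * 2) u-odd) (u-identity k v)
    ; v-even = v-identity u v
    ; p*2≡   = ≡.trans (cong (_* 2) (eval≡ 73 14)) (p-identity u v)
    ; q*2≡   = ≡.trans (cong (_* 2) (eval≡ 115 22)) (q-identity u v)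
    }
    where
    u-identity : ∀ k v → (1 + k * 2) * 11 + v * 2 ≡ 1 + (5 + k * 11 + v) * 2
    u-identity = solve-∀
    v-identity : ∀ u v → u * 18 + v * 4 ≡ (u * 9 + v * 2) * 2
    v-identity = solve-∀
    p-identity : ∀ u v → (u * 73 + v * 14) * 2 ≡ (u * 11 + v * 2) * 10 + (u * 18 + v * 4) * 2
    p-identity = solve-∀
    q-identity : ∀ u v → (u * 115 + v * 22) * 2 ≡ (u * 11 + v * 2) * 16 + (u * 18 + v * 4) * 3
    q-identity = solve-∀

-- Assembling the components by shape

data Shape : Set where
  path cycle : ℕ → Shape

shape : Piece A → Shape
shape (path xs)  = path (length xs)
shape (cycle xs) = cycle (length xs)

shape-map : ∀ (f : A → B) D → map shape (map (mapPiece f) D) ≡ map shape D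
shape-map f D = ≡.trans (sym (map-∘ D)) (map-cong shape-mapPiece D)
  where
  shape-mapPiece : ∀ P → shape (mapPiece f P) ≡ shape P
  shape-mapPiece (path xs)  = cong path (length-map f xs)
  shape-mapPiece (cycle xs) = cong cycle (length-map f xs)

-- The offsets leave exactly the components possible without isolated vertices: `path₊ 0` is P₂,
-- `cycle₊ 0` the triangle and `cycle₊ 1` is C₄.
path₊ cycle₊ : ℕ → Shape
path₊ m  = path (2 + m)
cycle₊ m = cycle (3 + m)

square : Shape
square = cycle₊ 1

record Labelling (s : List Shape) (k : ℕ) : Set where
  field
    pieces   : List (Piece ℕ)
    isolates : List ℕ
    shapes   : map shape pieces ↭ s
    length≡  : length isolates ≡ k
    system   : SumSystem (allEdges pieces) (isolates ++ allVerts pieces)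

Labelling-↭ : ∀ {s t k} → s ↭ t → Labelling s k → Labelling t k
Labelling-↭ σ l = record { Labelling l ; shapes = ↭-trans (Labelling.shapes l) σ }

Pairs Singles OddPairs : List Shape → Set
Pairs s    = ∃ λ D → map shape D ↭ s × ∃₂ (Pair D)
Singles s  = ∃ λ D → map shape D ↭ s × ∃ (Single D)
OddPairs s = ∃ λ D → map shape D ↭ s × OddPair D

Pairs⇒Labelling : ∀ {s} → Pairs s → Labelling s 2
Pairs⇒Labelling (D , σ , p , q , P) = record
  { pieces = D ; isolates = q ∷ p ∷ [] ; shapes = σ ; length≡ = refl ; system = Pair.system P }

Singles⇒Labelling : ∀ {s} → Singles s → Labelling s 1
Singles⇒Labelling (D , σ , r , Q) = record
  { pieces = D ; isolates = r ∷ [] ; shapes = σ ; length≡ = refl ; system = Single.system Q }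

Open-extend : ∀ {y y′ zs D r} → Open y y′ zs D r → ∀ m →
              ∃ λ xs → length xs ≡ m + (2 + length zs) × ∃ (Single (path xs ∷ D))
Open-extend O zero    = _ , refl , _ , Open⇒Single O
Open-extend O (suc m) with Open-extend (extend O) m
... | xs , e , Q = xs , ≡.trans e (ℕ.+-suc m _) , Q

Chain-extend : ∀ {y y′ y″ zs D r} → Chain y y′ y″ zs D r → ∀ m →
               ∃ λ xs → length xs ≡ m + (3 + length zs) × ∃₂ (Pair (cycle xs ∷ D))
Chain-extend K zero    = _ , refl , _ , _ , close-chain K
Chain-extend K (suc m) with Chain-extend (extend-chain K) m
... | xs , e , Q = xs , ≡.trans e (ℕ.+-suc m _) , Q

prepShape : ∀ {c c′ : Shape} {s t} → c ≡ c′ → s ↭ t → c ∷ s ↭ c′ ∷ t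
prepShape refl σ = prep _ σ

Open-path : ∀ {y y′ D r s} → Open y y′ [] D r → map shape D ↭ s → ∀ m → Singles (path₊ m ∷ s)
Open-path O σ m with Open-extend O m
... | xs , e , Q = _ , prepShape (cong path (≡.trans e (ℕ.+-comm m 2))) σ , Q

Pairs-path : ∀ {s} → Pairs s → ∀ m → Singles (path₊ m ∷ s)
Pairs-path (D , σ , _ , _ , P) = Open-path (Pair⇒Open P) σ

Singles-path : ∀ {s} → Singles s → ∀ m → Singles (path₊ m ∷ s)
Singles-path (D , σ , _ , Q) = Open-path (Single⇒Open Q) σ

Singles-paths : ∀ {s} → Singles s → ∀ ms → Singles (map path₊ ms ++ s)
Singles-paths Q []       = Q
Singles-paths Q (m ∷ ms) = Singles-path (Singles-paths Q ms) m

Pairs-cycle : ∀ {s} → Pairs s → ∀ {m} → m ≢ 1 → Pairs (cycle₊ m ∷ s)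
Pairs-cycle (D , σ , _ , _ , P) {zero}  _   = _ , prep _ σ , triangle P
Pairs-cycle _                   {suc zero} m≢1 = ⊥-elim (m≢1 refl)
Pairs-cycle (D , σ , _ , _ , P) {suc (suc m)} _ with Chain-extend (Pair⇒Chain P) m
... | xs , e , Q = _ , prepShape (cong cycle (≡.trans e (ℕ.+-comm m 5))) σ , Q

Pairs-cycles : ∀ {s} → Pairs s → ∀ {ms} → All (_≢ 1) ms → Pairs (map cycle₊ ms ++ s)
Pairs-cycles P []       = P
Pairs-cycles P (n ∷ ns) = Pairs-cycle (Pairs-cycles P ns) n

OddPairs-squares : ∀ {s} → OddPairs s → OddPairs (square ∷ square ∷ s)
OddPairs-squares (D , σ , O) =
  D′ , prep _ (prep _ (↭-trans (↭-reflexive (shape-map (_* 2) D)) σ)) , result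
  where open TwoSquares O

-- Except in the last list, one C₄ has labels that alternate between two opposite residues modulo
-- some m dividing all other labels: m = 11 for the first square of `three-squares`, m = 4 with the
-- triangle, m = 10 with the pentagon and the path. Unwanted sums at this C₄ then fail modulo m, or
-- would need the difference of two opposite vertices as a label, which it is not. Its edge sums are
-- multiples of m and occur among the labels of the other components and the isolates.
no-pieces three-squares square+triangle square+pentagon square+path₃ square+2path₂ : List (Piece ℕ)
no-pieces       = []
three-squares   = cycle (3 ∷ 19 ∷ 14 ∷ 30 ∷ []) ∷ cycle (44 ∷ 88 ∷ 99 ∷ 33 ∷ []) ∷
                  cycle (187 ∷ 22 ∷ 77 ∷ 132 ∷ []) ∷ []
square+triangle = cycle (4 ∷ 12 ∷ 16 ∷ []) ∷ cycle (1 ∷ 3 ∷ 9 ∷ 11 ∷ []) ∷ []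
square+pentagon = cycle (90 ∷ 50 ∷ 40 ∷ 10 ∷ 30 ∷ []) ∷ cycle (3 ∷ 27 ∷ 23 ∷ 7 ∷ []) ∷ []
square+path₃    = path (40 ∷ 10 ∷ 30 ∷ []) ∷ cycle (3 ∷ 27 ∷ 23 ∷ 7 ∷ []) ∷ []
square+2path₂   = path (8 ∷ 9 ∷ []) ∷ path (10 ∷ 17 ∷ []) ∷ cycle (3 ∷ 5 ∷ 4 ∷ 6 ∷ []) ∷ []

abstract
  -- Every p < q < 2p starts a construction; 7 and 11 are chosen because 7 is odd and 11/7 lies
  -- between 3/2 and 8/5, as `OddPair` demands.
  no-pieces-pair : Pair no-pieces 7 11
  no-pieces-pair = record
    { system = from-yes (sumSystem? (allEdges no-pieces) (11 ∷ 7 ∷ allVerts no-pieces))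
    ; top    = []
    ; p<q    = from-yes (7 ℕ.<? 11)
    ; q<2p   = from-yes (11 ℕ.<? 14)
    }

  three-squares-pair : Pair three-squares 209 319
  three-squares-pair = record
    { system = from-yes (sumSystem? (allEdges three-squares) (319 ∷ 209 ∷ allVerts three-squares))
    ; top    = from-yes (All.all? (ℕ._<? 209) (allVerts three-squares))
    ; p<q    = from-yes (209 ℕ.<? 319)
    ; q<2p   = from-yes (319 ℕ.<? 418)
    }

  square+triangle-pair : Pair square+triangle 20 28
  square+triangle-pair = record
    { system = from-yes (sumSystem? (allEdges square+triangle) (28 ∷ 20 ∷ allVerts square+triangle))
    ; top    = from-yes (All.all? (ℕ._<? 20) (allVerts square+triangle))
    ; p<q    = from-yes (20 ℕ.<? 28)
    ; q<2p   = from-yes (28 ℕ.<? 40)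
    }

  square+pentagon-pair : Pair square+pentagon 120 140
  square+pentagon-pair = record
    { system = from-yes (sumSystem? (allEdges square+pentagon) (140 ∷ 120 ∷ allVerts square+pentagon))
    ; top    = from-yes (All.all? (ℕ._<? 120) (allVerts square+pentagon))
    ; p<q    = from-yes (120 ℕ.<? 140)
    ; q<2p   = from-yes (140 ℕ.<? 240)
    }

  square+path₃-open : Open 40 10 (30 ∷ []) (cycle (3 ∷ 27 ∷ 23 ∷ 7 ∷ []) ∷ []) 50
  square+path₃-open = record
    { system = from-yes (sumSystem? (allEdges square+path₃) (50 ∷ allVerts square+path₃))
    ; r≡     = refl
    ; top    = from-yes (All.all? (ℕ._<? 40) (10 ∷ 30 ∷ 3 ∷ 27 ∷ 23 ∷ 7 ∷ []))
    }

  square+hexagon-chain : Chain 140 90 50 (40 ∷ 10 ∷ 30 ∷ []) (cycle (3 ∷ 27 ∷ 23 ∷ 7 ∷ []) ∷ []) 230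
  square+hexagon-chain = record
    { isOpen = extend (extend (extend square+path₃-open))
    ; y≡     = refl
    ; gap<   = from-yes (80 ℕ.<? 90)
    ; first< = from-yes (30 ℕ.<? 50)
    ; small  = from-yes (All.all? (ℕ._≤? 50) (40 ∷ 10 ∷ 30 ∷ 3 ∷ 27 ∷ 23 ∷ 7 ∷ []))
    }

  square+2path₂-single : Single square+2path₂ 27
  square+2path₂-single = record
    { system = from-yes (sumSystem? (allEdges square+2path₂) (27 ∷ allVerts square+2path₂))
    ; top    = from-yes (All.all? (ℕ._<? 27) (allVerts square+2path₂))
    }

  no-pieces-odd : OddPairs []
  no-pieces-odd = no-pieces , ↭-refl , record
    { u = 1 ; v = 2 ; k = 0 ; w = 1 ; isPair = no-pieces-pair
    ; u-odd = refl ; v-even = refl ; p*2≡ = refl ; q*2≡ = refl }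

  three-squares-odd : OddPairs (square ∷ square ∷ square ∷ [])
  three-squares-odd = three-squares , ↭-refl , record
    { u = 11 ; v = 154 ; k = 5 ; w = 77 ; isPair = three-squares-pair
    ; u-odd = refl ; v-even = refl ; p*2≡ = refl ; q*2≡ = refl }

OddPairs⇒Pairs : ∀ {s} → OddPairs s → Pairs s
OddPairs⇒Pairs (D , σ , O) = D , σ , _ , _ , OddPair.isPair O

several-squares : ∀ k → OddPairs (replicate (2 + k) square)
several-squares zero          = OddPairs-squares no-pieces-odd
several-squares (suc zero)    = three-squares-odd
several-squares (suc (suc k)) = OddPairs-squares (several-squares k)

square+cycle : ∀ {m} → m ≢ 1 → Pairs (cycle₊ m ∷ square ∷ [])
square+cycle {0} _ = square+triangle , ↭-refl , _ , _ , square+triangle-pair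
square+cycle {1} m≢1 = ⊥-elim (m≢1 refl)
-- The pentagon is checked directly: for 30, 10, 40, 50, 90 the inequality `gap<` would read 30 + 40
-- < 50. From six vertices on it holds, beginning with 30 + 50 < 90.
square+cycle {2} _ = square+pentagon , ↭-refl , _ , _ , square+pentagon-pair
square+cycle {suc (suc (suc m))} _ with Chain-extend square+hexagon-chain m
... | xs , e , Q = _ , prepShape (cong cycle (≡.trans e (ℕ.+-comm m 6))) ↭-refl , Q

square+path : ∀ m → Singles (path₊ (suc m) ∷ square ∷ [])
square+path m with Open-extend square+path₃-open m
... | xs , e , Q = _ , prepShape (cong path (≡.trans e (ℕ.+-comm m 3))) ↭-refl , Q

-- If one path has at least three vertices, it absorbs the square by `square+path` and the other
-- path is appended. Only two copies of P₂ need a labelling of their own.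
square+two-paths : ∀ m n → Singles (path₊ m ∷ path₊ n ∷ square ∷ [])
square+two-paths m       (suc n) = Singles-path (square+path n) m
square+two-paths (suc m) zero    with Singles-path (square+path m) 0
... | D , σ , Q = D , ↭-trans σ (swap _ _ ↭-refl) , Q
square+two-paths zero    zero    = square+2path₂ , ↭-refl , _ , square+2path₂-single

-- Read from right to left, this is the order in which the components are labelled.
normal : ℕ → List ℕ → List ℕ → List Shape
normal k cs ps = map path₊ ps ++ map cycle₊ cs ++ replicate k square

isolate-count : List ℕ → ℕ
isolate-count []      = 2
isolate-count (_ ∷ _) = 1

data Exceptional : ℕ → List ℕ → List ℕ → Set where
  C₄    : Exceptional 1 [] []
  C₄+P₂ : Exceptional 1 [] (0 ∷ [])

from-pairs : ∀ {s} → Pairs s → ∀ ps → Labelling (map path₊ ps ++ s) (isolate-count ps)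
from-pairs P []       = Pairs⇒Labelling P
from-pairs P (p ∷ ps) = Labelling-↭ (shift (path₊ p) (map path₊ ps) _)
  (Singles⇒Labelling (Singles-paths (Pairs-path P p) ps))

labelling : ∀ k {cs} ps → All (_≢ 1) cs → ¬ Exceptional k cs ps → Labelling (normal k cs ps) (isolate-count ps)
labelling zero          ps ns _ = from-pairs (Pairs-cycles (OddPairs⇒Pairs no-pieces-odd) ns) ps
labelling (suc (suc k)) ps ns _ = from-pairs (Pairs-cycles (OddPairs⇒Pairs (several-squares k)) ns) ps
labelling (suc zero) {c ∷ cs} ps (n ∷ ns) _ =
  Labelling-↭ (++⁺ˡ (map path₊ ps) (shift (cycle₊ c) (map cycle₊ cs) _))
    (from-pairs (Pairs-cycles (square+cycle n) ns) ps)
labelling (suc zero) []               [] ex = ⊥-elim (ex C₄)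
labelling (suc zero) (zero ∷ [])      [] ex = ⊥-elim (ex C₄+P₂)
labelling (suc zero) (suc p ∷ [])     [] ex = Singles⇒Labelling (square+path p)
labelling (suc zero) (p ∷ p′ ∷ ps)    [] ex =
  Labelling-↭ (↭-trans (shift (path₊ p) (map path₊ ps) _) (prep _ (shift (path₊ p′) (map path₊ ps) _)))
    (Singles⇒Labelling (Singles-paths (square+two-paths p p′) ps))

data Proper : Shape → Set where
  path  : ∀ m → Proper (path₊ m)
  cycle : ∀ m → Proper (cycle₊ m)

classify : ∀ {s} → All Proper s → ∃ λ k → ∃₂ λ cs ps → All (_≢ 1) cs × s ↭ normal k cs ps
classify [] = 0 , [] , [] , [] , ↭-refl
classify (path m ∷ va) with classify va
... | k , cs , ps , ns , σ = k , cs , m ∷ ps , ns , prep _ σ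
classify (cycle m ∷ va) with classify va | m ℕ.≟ 1
... | k , cs , ps , ns , σ | no n =
  k , m ∷ cs , ps , n ∷ ns , ↭-trans (prep _ σ) (↭-sym (shift (cycle₊ m) (map path₊ ps) _))
... | k , cs , ps , ns , σ | yes refl =
  suc k , cs , ps , ns , ↭-trans (prep _ σ) (↭-trans (↭-sym (shift square (map path₊ ps) _))
    (++⁺ˡ (map path₊ ps) (↭-sym (shift square (map cycle₊ cs) _))))

-- Degrees

module _ {n} (G : Graph n) (v : Fin n) where

  neighbour⁺ : ∀ {x} → adj G v x ≡ true → x ∈ₛ Vec.tabulate (adj G v)
  neighbour⁺ {x} e = Vec.lookup⇒[]= x _ (≡.trans (Vec.lookup∘tabulate (adj G v) x) e)

  neighbour⁻ : ∀ {x} → x ∈ₛ Vec.tabulate (adj G v) → adj G v x ≡ true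
  neighbour⁻ {x} m = ≡.trans (sym (Vec.lookup∘tabulate (adj G v) x)) (Vec.[]=⇒lookup m)

  1≤deg⇒neighbour : 1 ≤ deg G v → ∃ λ x → adj G v x ≡ true
  1≤deg⇒neighbour l with nonempty? (Vec.tabulate (adj G v))
  ... | yes (x , m) = x , neighbour⁻ m
  ... | no e = ⊥-elim (ℕ.<-irrefl (sym (≡.trans (cong ∣_∣ (Empty-unique e)) (∣⊥∣≡0 n))) l)

  two-neighbours⇒2≤deg : ∀ {x y} → x ≢ y → adj G v x ≡ true → adj G v y ≡ true → 2 ≤ deg G v
  two-neighbours⇒2≤deg x≢y ex ey =
    ℕ.≤-trans (s≤s (ℕ.≤-<-trans z≤n (x∈p⇒∣p-x∣<∣p∣ (x∈p∧x≢y⇒x∈p-y (neighbour⁺ ey) (x≢y ∘ sym)))))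
      (x∈p⇒∣p-x∣<∣p∣ (neighbour⁺ ex))

  three-neighbours⇒3≤deg : ∀ {x y z} → x ≢ y → x ≢ z → y ≢ z →
                           adj G v x ≡ true → adj G v y ≡ true → adj G v z ≡ true → 3 ≤ deg G v
  three-neighbours⇒3≤deg x≢y x≢z y≢z ex ey ez =
    ℕ.≤-trans (s≤s (ℕ.≤-trans (s≤s (ℕ.≤-<-trans z≤n (x∈p⇒∣p-x∣<∣p∣ z∈))) (x∈p⇒∣p-x∣<∣p∣ y∈)))
      (x∈p⇒∣p-x∣<∣p∣ (neighbour⁺ ex))
    where
    y∈ = x∈p∧x≢y⇒x∈p-y (neighbour⁺ ey) (x≢y ∘ sym)
    z∈ = x∈p∧x≢y⇒x∈p-y (x∈p∧x≢y⇒x∈p-y (neighbour⁺ ez) (x≢z ∘ sym)) (y≢z ∘ sym)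

  one-neighbour⇒deg≤1 : ∀ {x} → (∀ {y} → adj G v y ≡ true → y ≡ x) → deg G v ≤ 1
  one-neighbour⇒deg≤1 {x} only =
    subst (deg G v ≤_) (∣⁅x⁆∣≡1 x) (p⊆q⇒∣p∣≤∣q∣ (λ m → subst (_∈ₛ ⁅ x ⁆) (sym (only (neighbour⁻ m))) (x∈⁅x⁆ x)))

  2≤deg⇒neighbours : 2 ≤ deg G v → ∃₂ λ x y → x ≢ y × adj G v x ≡ true × adj G v y ≡ true
  2≤deg⇒neighbours l with 1≤deg⇒neighbour (ℕ.≤-trans (s≤s z≤n) l)
  ... | x , ex with Fin.any? (λ y → ¬? (x Fin.≟ y) ×-dec (adj G v y Bool.≟ true))
  ...   | yes (y , x≢y , ey) = x , y , x≢y , ex , ey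
  ...   | no none = ⊥-elim (ℕ.<⇒≱ l (one-neighbour⇒deg≤1 {x} only))
    where
    only : ∀ {y} → adj G v y ≡ true → y ≡ x
    only {y} ey with x Fin.≟ y
    ... | yes e  = sym e
    ... | no x≢y = ⊥-elim (none (y , x≢y , ey))

MaxDeg₂⇒NoThree : ∀ {n} (G : Graph n) → MaxDegAtMost G 2 → NoThree G
MaxDeg₂⇒NoThree G max {v} {x} {y} {z} ex ey ez with x Fin.≟ y | x Fin.≟ z | y Fin.≟ z
... | yes e | _     | _     = inj₁ e
... | _     | yes e | _     = inj₂ (inj₁ e)
... | _     | _     | yes e = inj₂ (inj₂ e)
... | no a  | no b  | no c  = ⊥-elim (ℕ.<⇒≱ (three-neighbours⇒3≤deg G v a b c ex ey ez) (max v))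

-- Sum labels of graphs

-- The isolates form the right summand, which keeps `splitAt` out of the later arguments. That no
-- isolate lies on an edge is part of `sum⇒edge`.
record SumLabels {n} (G : Graph n) (k : ℕ) : Set where
  field
    label           : Fin n ⊎ Fin k → ℕ
    label-injective : ∀ {x y} → label x ≡ label y → x ≡ y
    label-positive  : ∀ x → 1 ≤ label x
    edge⇒sum        : ∀ {a b} → adj G a b ≡ true → ∃ λ z → label z ≡ label (inj₁ a) + label (inj₁ b)
    sum⇒edge        : ∀ {x y z} → x ≢ y → label z ≡ label x + label y →
                ∃₂ λ a b → x ≡ inj₁ a × y ≡ inj₁ b × adj G a b ≡ true

⊕N-adj⁻ : ∀ {n k} (G : Graph n) x y → adj (G ⊕ N k) x y ≡ true →
          ∃₂ λ a b → splitAt n x ≡ inj₁ a × splitAt n y ≡ inj₁ b × adj G a b ≡ true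
⊕N-adj⁻ {n} G x y e with splitAt n x | splitAt n y
... | inj₁ a | inj₁ b = a , b , refl , refl , e
... | inj₁ _ | inj₂ _ with () ← e
... | inj₂ _ | inj₁ _ with () ← e
... | inj₂ _ | inj₂ _ with () ← e

⊕N-adj⁺ : ∀ {n k} (G : Graph n) x y {a b} → splitAt n {k} x ≡ inj₁ a → splitAt n y ≡ inj₁ b →
          adj G a b ≡ true → adj (G ⊕ N k) x y ≡ true
⊕N-adj⁺ {n} G x y p q e with splitAt n x | splitAt n y
⊕N-adj⁺ G x y refl refl e | inj₁ a | inj₁ b = e

adj⇒≢ : ∀ {n} (G : Graph n) {a b} → adj G a b ≡ true → a ≢ b
adj⇒≢ G {a} e refl with ≡.trans (sym e) (irrefl G a)
... | ()

SumLabels⇒IsSumGraph : ∀ {n k} {G : Graph n} → SumLabels G k → IsSumGraph (G ⊕ N k)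
SumLabels⇒IsSumGraph {n} {k} {G} S =
  label ∘ splitAt n , splitAt-injective ∘ label-injective , label-positive ∘ splitAt n , λ x y x≢y → mk⇔ (fwd x y) (bwd x≢y)
  where
  open SumLabels S
  splitAt-injective : ∀ {x y} → splitAt n {k} x ≡ splitAt n y → x ≡ y
  splitAt-injective {x} {y} e =
    ≡.trans (sym (Fin.join-splitAt n k x)) (≡.trans (cong (join n k) e) (Fin.join-splitAt n k y))
  fwd : ∀ x y → adj (G ⊕ N k) x y ≡ true → ∃ λ z → label (splitAt n z) ≡ label (splitAt n x) + label (splitAt n y)
  fwd x y e with ⊕N-adj⁻ G x y e
  ... | a , b , p , q , e′ with edge⇒sum e′
  ...   | z , s = join n k z , ≡.trans (cong label (Fin.splitAt-join n k z))
                    (≡.trans s (sym (cong₂ (λ i j → label i + label j) p q)))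
  bwd : ∀ {x y} → x ≢ y → (∃ λ z → label (splitAt n z) ≡ label (splitAt n x) + label (splitAt n y)) →
        adj (G ⊕ N k) x y ≡ true
  bwd {x} {y} x≢y (z , s) with sum⇒edge (x≢y ∘ splitAt-injective) s
  ... | a , b , p , q , e = ⊕N-adj⁺ G x y p q e

IsSumGraph⇒SumLabels : ∀ {n k} {G : Graph n} → IsSumGraph (G ⊕ N k) → SumLabels G k
IsSumGraph⇒SumLabels {n} {k} {G} (ℓ , inj , pos , edge⇔) = record
  { label     = ℓ ∘ join n k
  ; label-injective = join-injective ∘ inj
  ; label-positive = pos ∘ join n k
  ; edge⇒sum  = λ {a} {b} e →
      let z , s = Equivalence.to (edge⇔ (join n k (inj₁ a)) (join n k (inj₁ b))
                    (adj⇒≢ G e ∘ inj₁-injective ∘ join-injective))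
                    (⊕N-adj⁺ G _ _ (Fin.splitAt-join n k (inj₁ a)) (Fin.splitAt-join n k (inj₁ b)) e)
      in splitAt n z , ≡.trans (cong ℓ (Fin.join-splitAt n k z)) s
  ; sum⇒edge  = λ {x} {y} {z} x≢y s →
      let a , b , p , q , e = ⊕N-adj⁻ G _ _ (Equivalence.from (edge⇔ (join n k x) (join n k y)
                                (x≢y ∘ join-injective)) (join n k z , s))
      in a , b , ≡.trans (sym (Fin.splitAt-join n k x)) p , ≡.trans (sym (Fin.splitAt-join n k y)) q , e
  }
  where
  join-injective : ∀ {x y} → join n k x ≡ join n k y → x ≡ y
  join-injective {x} {y} e =
    ≡.trans (sym (Fin.splitAt-join n k x)) (≡.trans (cong (splitAt n) e) (Fin.splitAt-join n k y))

-- Carrying labels from pieces to vertices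

unique-map-injective : ∀ {f : A → B} {xs} → Unique (map f xs) → ∀ {x y} → x ∈ xs → y ∈ xs → f x ≡ f y → x ≡ y
unique-map-injective (_ ∷ _) (here refl) (here refl) _ = refl
unique-map-injective {f = f} (p ∷ _) (here refl) (there y) e = ⊥-elim (All.lookup p (∈-map⁺ f y) e)
unique-map-injective {f = f} (p ∷ _) (there x) (here refl) e = ⊥-elim (All.lookup p (∈-map⁺ f x) (sym e))
unique-map-injective (_ ∷ u) (there x) (there y) e = unique-map-injective u x y e

zip-lists : (xs : List A) (ys : List B) → length xs ≡ length ys →
            ∃ λ zs → map proj₁ zs ≡ xs × map proj₂ zs ≡ ys
zip-lists []       []       _ = [] , refl , refl
zip-lists (x ∷ xs) (y ∷ ys) e with zip-lists xs ys (ℕ.suc-injective e)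
... | zs , refl , refl = (x , y) ∷ zs , refl , refl

zip-piece : (P : Piece A) (Q : Piece B) → shape P ≡ shape Q →
            ∃ λ R → mapPiece proj₁ R ≡ P × mapPiece proj₂ R ≡ Q
zip-piece (path xs) (path ys) e with zip-lists xs ys (path-injective e)
  where
  path-injective : ∀ {m n} → path m ≡ path n → m ≡ n
  path-injective refl = refl
... | zs , refl , refl = path zs , refl , refl
zip-piece (cycle xs) (cycle ys) e with zip-lists xs ys (cycle-injective e)
  where
  cycle-injective : ∀ {m n} → cycle m ≡ cycle n → m ≡ n
  cycle-injective refl = refl
... | zs , refl , refl = cycle zs , refl , refl

zip-pieces : (D : List (Piece A)) (D′ : List (Piece B)) → map shape D ≡ map shape D′ →
             ∃ λ Z → map (mapPiece proj₁) Z ≡ D × map (mapPiece proj₂) Z ≡ D′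
zip-pieces []      []        _ = [] , refl , refl
zip-pieces (P ∷ D) (P′ ∷ D′) e
  with zip-piece P P′ (proj₁ (∷-injective e)) | zip-pieces D D′ (proj₂ (∷-injective e))
... | R , refl , refl | Z , refl , refl = R ∷ Z , refl , refl

map-on : ∀ {C : Set} {f : A → C} {g : B → A} {h : B → C} xs → (∀ {x} → x ∈ xs → f (g x) ≡ h x) →
         map f (map g xs) ≡ map h xs
map-on []       eq = refl
map-on (x ∷ xs) eq = cong₂ _∷_ (eq (here refl)) (map-on xs (eq ∘ there))

mapPiece-on : ∀ {C : Set} {f : A → C} {g : B → A} {h : B → C} P → (∀ {x} → x ∈ verts P → f (g x) ≡ h x) →
              mapPiece f (mapPiece g P) ≡ mapPiece h P
mapPiece-on (path xs)  eq = cong path (map-on xs eq)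
mapPiece-on (cycle xs) eq = cong cycle (map-on xs eq)

mapPieces-on : ∀ {C : Set} {f : A → C} {g : B → A} {h : B → C} D → (∀ {x} → x ∈ allVerts D → f (g x) ≡ h x) →
               map (mapPiece f) (map (mapPiece g) D) ≡ map (mapPiece h) D
mapPieces-on []      eq = refl
mapPieces-on (P ∷ D) eq = cong₂ _∷_ (mapPiece-on P (eq ∘ ∈-++⁺ˡ)) (mapPieces-on D (eq ∘ ∈-++⁺ʳ (verts P)))

-- Zipping the two lists of pieces yields the graph of `f`: it is total because the pieces of `Δ`
-- span, and single-valued because their vertices are distinct.
relabelling : ∀ {n} {G : Graph n} (Δ : Decomposition G) (D : List (Piece B)) →
              map shape (Decomposition.pieces Δ) ≡ map shape D →
              ∃ λ (f : Fin n → B) → map (mapPiece f) (Decomposition.pieces Δ) ≡ D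
relabelling {B} {n} Δ D e with zip-pieces (Decomposition.pieces Δ) D e
... | Z , eq , refl = f , subst (λ D′ → map (mapPiece f) D′ ≡ map (mapPiece proj₂) Z) eq (mapPieces-on Z agrees)
  where
  open Decomposition Δ
  verts≡ : allVerts pieces ≡ map proj₁ (allVerts Z)
  verts≡ = ≡.trans (cong allVerts (sym eq)) (allVerts-map proj₁ Z)
  entry : ∀ v → ∃ λ z → z ∈ allVerts Z × v ≡ proj₁ z
  entry v = ∈-map⁻ proj₁ (subst (v ∈_) verts≡ (spanning v))
  f : Fin n → B
  f v = proj₂ (proj₁ (entry v))
  agrees : ∀ {z} → z ∈ allVerts Z → f (proj₁ z) ≡ proj₂ z
  agrees {z} z∈ = cong proj₂ (unique-map-injective (subst Unique verts≡ distinct)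
    (proj₁ (proj₂ (entry (proj₁ z)))) z∈ (sym (proj₂ (proj₂ (entry (proj₁ z))))))

module Relabelled {n} {G : Graph n} (Δ : Decomposition G) {f : Fin n → B} {D : List (Piece B)}
                  (D≡ : map (mapPiece f) (Decomposition.pieces Δ) ≡ D) (D-unique : Unique (allVerts D)) where
  open Decomposition Δ

  verts≡ : allVerts D ≡ map f (allVerts pieces)
  verts≡ = ≡.trans (cong allVerts (sym D≡)) (allVerts-map f pieces)

  edges≡ : allEdges D ≡ map (Prod.map f f) (allEdges pieces)
  edges≡ = ≡.trans (cong allEdges (sym D≡)) (allEdges-map f pieces)

  f-∈ : ∀ v → f v ∈ allVerts D
  f-∈ v = subst (f v ∈_) (sym verts≡) (∈-map⁺ f (spanning v))

  f-onto : ∀ {b} → b ∈ allVerts D → ∃ λ v → b ≡ f v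
  f-onto b∈ with ∈-map⁻ f (subst (_ ∈_) verts≡ b∈)
  ... | v , _ , e = v , e

  f-injective : ∀ {u v} → f u ≡ f v → u ≡ v
  f-injective {u} {v} = unique-map-injective (subst Unique verts≡ D-unique) (spanning u) (spanning v)

  adj⇒joined : ∀ {u v} → adj G u v ≡ true → Joined (allEdges D) (f u) (f v)
  adj⇒joined e = subst (λ E → Joined E _ _) (sym edges≡) (Joined-map⁺ f (adj⇒ e))

  joined⇒adj : ∀ {u v} → Joined (allEdges D) (f u) (f v) → adj G u v ≡ true
  joined⇒adj j with Joined-map⁻ f {allEdges pieces} (subst (λ E → Joined E _ _) edges≡ j)
  ... | a , b , p , q , k with f-injective p | f-injective q
  ...   | refl | refl = ⇒adj k

∈⇒lookup : ∀ {x : A} {xs} → x ∈ xs → ∃ λ i → lookup xs i ≡ x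
∈⇒lookup (here refl) = zero , refl
∈⇒lookup (there m) with ∈⇒lookup m
... | i , e = suc i , e

unique-lookup : ∀ {xs : List A} → Unique xs → ∀ {i j} → lookup xs i ≡ lookup xs j → i ≡ j
unique-lookup (_ ∷ _) {zero}  {zero}  _ = refl
unique-lookup {xs = _ ∷ xs} (p ∷ _) {zero}  {suc j} e = ⊥-elim (All.lookup p (∈-lookup {xs = xs} j) e)
unique-lookup {xs = _ ∷ xs} (p ∷ _) {suc i} {zero}  e = ⊥-elim (All.lookup p (∈-lookup {xs = xs} i) (sym e))
unique-lookup (_ ∷ u) {suc i} {suc j} e = cong suc (unique-lookup u e)

Labelling⇒SumLabels : ∀ {n} {G : Graph n} (Δ : Decomposition G) {k} →
                      Labelling (map shape (Decomposition.pieces Δ)) k → SumLabels G k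
Labelling⇒SumLabels {n} {G} Δ {k} L with ↭-map-inv shape (Labelling.shapes L)
-- The permutation of shapes lifts to one of pieces, so that `D` has the shapes of `Δ` in the same
-- order.
... | D , e , σ with relabelling Δ D e
...   | f , D≡ = subst (SumLabels G) (Labelling.length≡ L) record
  { label     = label
  ; label-injective = injective _ _
  ; label-positive = λ x → All.lookup (SumSystem.positive system) (label-∈ x)
  ; edge⇒sum  = λ e → label-onto (joined-sum (adj⇒joined e))
  ; sum⇒edge  = λ {x} {y} {z} x≢y s → joined-edge x y
                  (SumSystem.complete system (label-∈ x) (label-∈ y) (x≢y ∘ injective x y)
                    (subst (_∈ I ++ allVerts D) s (label-∈ z)))
  }
  where
  I : List ℕ
  I = Labelling.isolates L
  system : SumSystem (allEdges D) (I ++ allVerts D)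
  system = record
    { unique   = S.unique
    ; positive = S.positive
    ; sound    = All-resp-↭ (concatMap-↭ σ) S.sound
    ; complete = λ a∈ b∈ ne s∈ → Joined-↭ (concatMap-↭ σ) (S.complete a∈ b∈ ne s∈)
    }
    where module S = SumSystem (SumSystem-↭ (++⁺ˡ I (concatMap-↭ σ)) (Labelling.system L))
  open Relabelled Δ D≡ (Unique-++ʳ I (SumSystem.unique system))
  label : Fin n ⊎ Fin (length I) → ℕ
  label = [ f , lookup I ]
  label-∈ : ∀ x → label x ∈ I ++ allVerts D
  label-∈ (inj₁ v) = ∈-++⁺ʳ I (f-∈ v)
  label-∈ (inj₂ j) = ∈-++⁺ˡ (∈-lookup {xs = I} j)
  label-onto : ∀ {a} → a ∈ I ++ allVerts D → ∃ λ z → label z ≡ a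
  label-onto a∈ with ∈-++⁻ I a∈
  ... | inj₁ m = let i , e = ∈⇒lookup m in inj₂ i , e
  ... | inj₂ m = let v , e = f-onto m in inj₁ v , sym e
  injective : ∀ x y → label x ≡ label y → x ≡ y
  injective (inj₁ u) (inj₁ v) e = cong inj₁ (f-injective e)
  injective (inj₂ i) (inj₂ j) e = cong inj₂ (unique-lookup (Unique-++ˡ I (SumSystem.unique system)) e)
  injective (inj₁ u) (inj₂ j) e =
    ⊥-elim (Unique-disjoint I (SumSystem.unique system) (∈-lookup j) (subst (_∈ allVerts D) e (f-∈ u)))
  injective (inj₂ i) (inj₁ v) e =
    ⊥-elim (Unique-disjoint I (SumSystem.unique system) (∈-lookup i) (subst (_∈ allVerts D) (sym e) (f-∈ v)))
  joined-sum : ∀ {a b} → Joined (allEdges D) a b → a + b ∈ I ++ allVerts D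
  joined-sum (inj₁ m) = All.lookup (SumSystem.sound system) m
  joined-sum {a} {b} (inj₂ m) = subst (_∈ I ++ allVerts D) (ℕ.+-comm b a) (All.lookup (SumSystem.sound system) m)
  joined-edge : ∀ x y → Joined (allEdges D) (label x) (label y) →
                ∃₂ λ a b → x ≡ inj₁ a × y ≡ inj₁ b × adj G a b ≡ true
  joined-edge (inj₁ a) (inj₁ b) j = a , b , refl , refl , joined⇒adj j
  joined-edge (inj₂ i) y j =
    ⊥-elim (Unique-disjoint I (SumSystem.unique system) (∈-lookup i) (Joined-∈ D j))
  joined-edge (inj₁ a) (inj₂ i) j =
    ⊥-elim (Unique-disjoint I (SumSystem.unique system) (∈-lookup i) (Joined-∈ D (Joined-sym {E = allEdges D} j)))

-- A relabelling with values in the vertices of `H` is the isomorphism.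
same-shape⇒≅ : ∀ {m n} {G : Graph m} {H : Graph n} (Δ : Decomposition G) (Δ′ : Decomposition H) →
               map shape (Decomposition.pieces Δ′) ↭ map shape (Decomposition.pieces Δ) → G ≅ H
same-shape⇒≅ {G = G} {H} Δ Δ′ τ with ↭-map-inv shape τ
... | D , e , σ with relabelling Δ D e
...   | f , D≡ = ⤖⇒↔ (mk⤖ (f-injective , λ y → let v , p = f-onto (∈-resp-↭ (concatMap-↭ σ) (Δ′.spanning y))
                                            in v , λ { refl → sym p })) , same-adj
  where
  module Δ′ = Decomposition Δ′
  open Relabelled Δ D≡ (Unique-↭ (concatMap-↭ σ) Δ′.distinct)
  same-adj : ∀ i j → adj H (f i) (f j) ≡ adj G i j
  same-adj i j with adj G i j in eG | adj H (f i) (f j) in eH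
  ... | true  | true  = refl
  ... | false | false = refl
  ... | true  | false = ≡.trans (sym eH) (Δ′.⇒adj (Joined-↭ (↭-sym (concatMap-↭ σ)) (adj⇒joined eG)))
  ... | false | true  = ≡.trans (sym (joined⇒adj (Joined-↭ (concatMap-↭ σ) (Δ′.adj⇒ eH)))) eG

-- Lower bounds

two-distinct : ∀ {k} {i j : Fin k} → i ≢ j → 2 ≤ k
two-distinct {suc zero}    {zero} {zero} i≢j = ⊥-elim (i≢j refl)
two-distinct {suc (suc k)} _ = s≤s (s≤s z≤n)

three-distinct : ∀ {k} {i j l : Fin k} → i ≢ j → i ≢ l → j ≢ l → 3 ≤ k
three-distinct {suc zero} {zero} {zero} i≢j _ _ = ⊥-elim (i≢j refl)
three-distinct {suc (suc zero)} {0F} {0F} i≢j _ _ = ⊥-elim (i≢j refl)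
three-distinct {suc (suc zero)} {0F} {1F} {0F} _ i≢l _ = ⊥-elim (i≢l refl)
three-distinct {suc (suc zero)} {0F} {1F} {1F} _ _ j≢l = ⊥-elim (j≢l refl)
three-distinct {suc (suc zero)} {1F} {0F} {0F} _ _ j≢l = ⊥-elim (j≢l refl)
three-distinct {suc (suc zero)} {1F} {0F} {1F} _ i≢l _ = ⊥-elim (i≢l refl)
three-distinct {suc (suc zero)} {1F} {1F} i≢j _ _ = ⊥-elim (i≢j refl)
three-distinct {suc (suc (suc k))} _ _ _ = s≤s (s≤s (s≤s z≤n))

maximum : ∀ {n} (f : Fin (suc n) → ℕ) → ∃ λ v → ∀ u → f u ≤ f v
maximum {zero}  f = zero , λ { zero → ℕ.≤-refl }
maximum {suc n} f with maximum (f ∘ suc)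
... | v , max with ℕ.≤-total (f zero) (f (suc v))
...   | inj₁ l = suc v , λ { zero → l ; (suc u) → max u }
...   | inj₂ l = zero , λ { zero → ℕ.≤-refl ; (suc u) → ℕ.≤-trans (max u) l }

module LowerBound {n k} {G : Graph n} (S : SumLabels G k) where
  open SumLabels S

  λᵥ : Fin n → ℕ
  λᵥ v = label (inj₁ v)

  λ-injective : ∀ {a b} → λᵥ a ≡ λᵥ b → a ≡ b
  λ-injective = inj₁-injective ∘ label-injective

  λ-positive : ∀ a → 1 ≤ λᵥ a
  λ-positive a = label-positive (inj₁ a)

  <⇒≢ : ∀ {x y} → label x < label y → x ≢ y
  <⇒≢ l refl = ℕ.<-irrefl refl l

  above-maximum : ∀ {v} → (∀ u → λᵥ u ≤ λᵥ v) → ∀ {u} → adj G v u ≡ true →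
                  ∃ λ j → label (inj₂ j) ≡ λᵥ v + λᵥ u
  above-maximum {v} max {u} e with edge⇒sum e
  ... | inj₂ j , s = j , s
  ... | inj₁ w , s = ⊥-elim (ℕ.<⇒≱ (ℕ.m<m+n (λᵥ v) (λ-positive u)) (subst (_≤ λᵥ v) s (max w)))

  degree-bound : MaxDegAtMost G 2 → ∀ {d} → Fin n → (∀ v → d ≤ deg G v) → d ≤ k
  degree-bound Δ≤2 {d} v₀ d≤ with top v₀
    where
    top : ∀ {m} {f : Fin m → ℕ} → Fin m → ∃ λ v → ∀ u → f u ≤ f v
    top {suc m} {f} _ = maximum f
  ... | v , max = bound d (d≤ v)
    where
    bound : ∀ d → d ≤ deg G v → d ≤ k
    bound 0 _ = z≤n
    bound 1 l with 1≤deg⇒neighbour G v l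
    ... | u , e with above-maximum max e
    ...   | j , _ = ℕ.≤-trans (s≤s z≤n) (Fin.toℕ<n j)
    bound 2 l with 2≤deg⇒neighbours G v l
    ... | u , w , u≢w , eu , ew with above-maximum max eu | above-maximum max ew
    ...   | i , p | j , q = two-distinct {i = i} {j} λ { refl →
      u≢w (λ-injective (ℕ.+-cancelˡ-≡ (λᵥ v) _ _ (≡.trans (sym p) q))) }
    bound (suc (suc (suc d))) l = ⊥-elim (ℕ.<⇒≱ (ℕ.≤-trans (s≤s (s≤s (s≤s z≤n))) l) (Δ≤2 v))

-- Neighbours are taken in all of `G`, so the cycle is a component. `Q` holds for every vertex in
-- the case of C₄, and for the vertices off the extra edge in the case of C₄ + P₂.
record Square {n} (G : Graph n) (Q : Fin n → Set) (a b c d : Fin n) : Set where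
  field
    ab : adj G a b ≡ true
    bc : adj G b c ≡ true
    cd : adj G c d ≡ true
    da : adj G d a ≡ true
    at-a : ∀ {x} → adj G a x ≡ true → x ≡ d ⊎ x ≡ b
    at-b : ∀ {x} → adj G b x ≡ true → x ≡ a ⊎ x ≡ c
    at-c : ∀ {x} → adj G c x ≡ true → x ≡ b ⊎ x ≡ d
    at-d : ∀ {x} → adj G d x ≡ true → x ≡ c ⊎ x ≡ a
    a≢c : a ≢ c
    b≢d : b ≢ d
    inside : ∀ {x} → Q x → x ≡ a ⊎ x ≡ b ⊎ x ≡ c ⊎ x ≡ d

rotate : ∀ {n} {G : Graph n} {Q a b c d} → Square G Q a b c d → Square G Q b c d a
rotate s = record
  { ab = bc ; bc = cd ; cd = da ; da = ab ; at-a = at-b ; at-b = at-c ; at-c = at-d ; at-d = at-a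
  ; a≢c = b≢d ; b≢d = a≢c ∘ sym
  ; inside = λ q → [ inj₂ ∘ inj₂ ∘ inj₂ , [ inj₁ , [ inj₂ ∘ inj₁ , inj₂ ∘ inj₂ ∘ inj₁ ] ] ] (inside q) }
  where open Square s

reflect : ∀ {n} {G : Graph n} {Q a b c d} → Square G Q a b c d → Square G Q a d c b
reflect {G = G} s = record
  { ab = flip da ; bc = flip cd ; cd = flip bc ; da = flip ab
  ; at-a = Sum.swap ∘ at-a ; at-b = Sum.swap ∘ at-d ; at-c = Sum.swap ∘ at-c ; at-d = Sum.swap ∘ at-b
  ; a≢c = a≢c ; b≢d = b≢d ∘ sym
  ; inside = λ q → [ inj₁ , [ inj₂ ∘ inj₂ ∘ inj₂ , [ inj₂ ∘ inj₂ ∘ inj₁ , inj₂ ∘ inj₁ ] ] ] (inside q) }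
  where
  open Square s
  flip : ∀ {x y} → adj G x y ≡ true → adj G y x ≡ true
  flip = ≡.trans (adj-sym G _ _)

module SquareBound {n k} {G : Graph n} (S : SumLabels G k) where
  open SumLabels S
  open LowerBound S

  record Sorted (Q : Fin n → Set) (a b c d : Fin n) : Set where
    field
      isSquare : Square G Q a b c d
      c<a    : λᵥ c < λᵥ a
      b≤a    : λᵥ b ≤ λᵥ a
      d≤a    : λᵥ d ≤ λᵥ a
      b<d    : λᵥ b < λᵥ d

  ≤∧≢⇒< : ∀ {a b} → λᵥ a ≤ λᵥ b → a ≢ b → λᵥ a < λᵥ b
  ≤∧≢⇒< l ne = ℕ.≤∧≢⇒< l (ne ∘ λ-injective)

  -- The symmetries of the square suffice: `opposite` moves the larger label of each diagonal to a
  -- and to d, and `larger` exchanges the diagonals if d exceeds a. Injectivity makes the required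
  -- inequalities strict.
  sort : ∀ {Q a b c d} → Square G Q a b c d → ∃₂ λ a b → ∃₂ λ c d → Sorted Q a b c d
  sort {Q} {a} {b} {c} {d} s with ℕ.≤-total (λᵥ a) (λᵥ c) | ℕ.≤-total (λᵥ b) (λᵥ d)
  ... | ac | bd = opposite s ac bd
    where
    from-top : ∀ {a b c d} → Square G Q a b c d → λᵥ c ≤ λᵥ a → λᵥ b ≤ λᵥ d → λᵥ d ≤ λᵥ a →
               ∃₂ λ a b → ∃₂ λ c d → Sorted Q a b c d
    from-top s ca bd da = _ , _ , _ , _ , record
      { isSquare = s ; c<a = ≤∧≢⇒< ca (Square.a≢c s ∘ sym) ; b≤a = ℕ.≤-trans bd da ; d≤a = da
      ; b<d = ≤∧≢⇒< bd (Square.b≢d s) }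
    larger : ∀ {a b c d} → Square G Q a b c d → λᵥ c ≤ λᵥ a → λᵥ b ≤ λᵥ d →
             ∃₂ λ a b → ∃₂ λ c d → Sorted Q a b c d
    larger {a} {b} {c} {d} s ca bd with ℕ.≤-total (λᵥ d) (λᵥ a)
    ... | inj₁ da = from-top s ca bd da
    ... | inj₂ ad = from-top (reflect (rotate (rotate (rotate s)))) bd ca ad
    opposite : ∀ {a b c d} → Square G Q a b c d → λᵥ a ≤ λᵥ c ⊎ λᵥ c ≤ λᵥ a → λᵥ b ≤ λᵥ d ⊎ λᵥ d ≤ λᵥ b →
               ∃₂ λ a b → ∃₂ λ c d → Sorted Q a b c d
    opposite s (inj₁ ac) (inj₁ bd) = larger (reflect (rotate (rotate s))) ac bd
    opposite s (inj₁ ac) (inj₂ db) = larger (rotate (rotate s)) ac db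
    opposite s (inj₂ ca) (inj₁ bd) = larger s ca bd
    opposite s (inj₂ ca) (inj₂ db) = larger (reflect s) ca db

  module _ {Q a b c d} (T : Sorted Q a b c d) where
    open Sorted T
    open Square isSquare

    α β γ δ : ℕ
    α = λᵥ a
    β = λᵥ b
    γ = λᵥ c
    δ = λᵥ d

    Outside : Fin n ⊎ Fin k → Set
    Outside x = ∀ {v} → x ≡ inj₁ v → ¬ Q v

    large-outside : ∀ {x} → α < label x → Outside x
    large-outside α<x refl q with inside q
    ... | inj₁ refl               = ℕ.<-irrefl refl α<x
    ... | inj₂ (inj₁ refl)        = ℕ.<⇒≱ α<x b≤a
    ... | inj₂ (inj₂ (inj₁ refl)) = ℕ.<⇒≱ α<x (ℕ.<⇒≤ c<a)
    ... | inj₂ (inj₂ (inj₂ refl)) = ℕ.<⇒≱ α<x d≤a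

    sum-ab : ∃ λ x → label x ≡ α + β
    sum-ab = edge⇒sum ab
    sum-ad : ∃ λ x → label x ≡ α + δ
    sum-ad = edge⇒sum (≡.trans (adj-sym G _ _) da)
    sum-cb : ∃ λ x → label x ≡ γ + β
    sum-cb = edge⇒sum (≡.trans (adj-sym G _ _) bc)
    sum-cd : ∃ λ x → label x ≡ γ + δ
    sum-cd = edge⇒sum cd

    neighbour-of : ∀ {x v z} → label z ≡ label x + λᵥ v → x ≢ inj₁ v →
                   ∃ λ u → x ≡ inj₁ u × adj G v u ≡ true
    neighbour-of s x≢v with sum⇒edge x≢v s
    ... | u , _ , refl , refl , e = u , refl , ≡.trans (adj-sym G _ _) e

    -- Otherwise α + δ = (α + β) + γ, so the vertex labelled α + β would be adjacent to c. It would
    -- be b or d, but α + β exceeds both β and δ.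
    c+b≢d : γ + β ≢ δ
    c+b≢d e with sum-ab | sum-ad
    ... | x , p | z , q with neighbour-of {x} {c} {z} shifted x≢c
      where
      open ≡.≡-Reasoning
      shifted : label z ≡ label x + γ
      shifted = begin
        label z     ≡⟨ q ⟩
        α + δ       ≡⟨ cong (α +_) (≡.trans (sym e) (ℕ.+-comm γ β)) ⟩
        α + (β + γ) ≡⟨ ℕ.+-assoc α β γ ⟨
        α + β + γ   ≡⟨ cong (_+ γ) p ⟨
        label x + γ ∎
      x≢c : x ≢ inj₁ c
      x≢c refl = ℕ.<⇒≱ c<a (ℕ.≤-trans (ℕ.m≤m+n α β) (ℕ.≤-reflexive (sym p)))
    ...   | u , refl , eu with at-c eu
    ...     | inj₁ refl = ℕ.<⇒≱ (ℕ.m<n+m β (λ-positive a)) (ℕ.≤-reflexive (sym p))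
    ...     | inj₂ refl = ℕ.<⇒≱ (ℕ.<-≤-trans (ℕ.m<m+n α (λ-positive b)) (ℕ.≤-reflexive (sym p))) d≤a

    -- Otherwise α + δ = (γ + δ) + β, so the vertex labelled γ + δ would be adjacent to b. It would
    -- be a, forcing β = δ, or c, forcing δ = 0.
    c+b≢a : γ + β ≢ α
    c+b≢a e with sum-cd | sum-ad
    ... | x , p | z , q with neighbour-of {x} {b} {z} shifted x≢b
      where
      open ≡.≡-Reasoning
      shifted : label z ≡ label x + β
      shifted = begin
        label z     ≡⟨ q ⟩
        α + δ       ≡⟨ cong (_+ δ) e ⟨
        γ + β + δ   ≡⟨ ℕ.+-assoc γ β δ ⟩
        γ + (β + δ) ≡⟨ cong (γ +_) (ℕ.+-comm β δ) ⟩
        γ + (δ + β) ≡⟨ ℕ.+-assoc γ δ β ⟨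
        γ + δ + β   ≡⟨ cong (_+ β) p ⟨
        label x + β ∎
      x≢b : x ≢ inj₁ b
      x≢b refl = ℕ.<⇒≱ b<d (ℕ.≤-trans (ℕ.m≤n+m δ γ) (ℕ.≤-reflexive (sym p)))
    ...   | u , refl , eu with at-b eu
    ...     | inj₁ refl = ℕ.<-irrefl (ℕ.+-cancelˡ-≡ γ β δ (≡.trans e p)) b<d
    ...     | inj₂ refl = ℕ.<⇒≱ (ℕ.m<m+n γ (λ-positive d)) (ℕ.≤-reflexive (sym p))

    three-outside : ∃ λ x → ∃₂ λ y z → Outside x × Outside y × Outside z ×
                    label x < label y × label y < label z × label y ≡ α + β × label z ≡ α + δ
    three-outside with sum-cb | sum-ab | sum-ad
    ... | x , p | y , q | z , r =
      x , y , z , x-outside ,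
      large-outside (subst (α <_) (sym q) (ℕ.m<m+n α (λ-positive b))) ,
      large-outside (subst (α <_) (sym r) (ℕ.m<m+n α (λ-positive d))) ,
      subst₂ _<_ (sym p) (sym q) (ℕ.+-monoˡ-< β c<a) ,
      subst₂ _<_ (sym q) (sym r) (ℕ.+-monoʳ-< α b<d) , q , r
      where
      x-outside : Outside x
      x-outside refl m with inside m
      ... | inj₁ refl               = c+b≢a (sym p)
      ... | inj₂ (inj₁ refl)        = ℕ.<⇒≱ (ℕ.m<n+m β (λ-positive c)) (ℕ.≤-reflexive (sym p))
      ... | inj₂ (inj₂ (inj₁ refl)) = ℕ.<⇒≱ (ℕ.m<m+n γ (λ-positive b)) (ℕ.≤-reflexive (sym p))
      ... | inj₂ (inj₂ (inj₂ refl)) = c+b≢d (sym p)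

  square-bound : ∀ {a b c d} → Square G (λ _ → ⊤) a b c d → 3 ≤ k
  square-bound s with sort s
  ... | _ , _ , _ , _ , T with three-outside T
  ...   | inj₁ _ , _ , _ , ox , _ , _ , _ = ⊥-elim (ox refl tt)
  ...   | inj₂ _ , inj₁ _ , _ , _ , oy , _ , _ = ⊥-elim (oy refl tt)
  ...   | inj₂ _ , inj₂ _ , inj₁ _ , _ , _ , oz , _ = ⊥-elim (oz refl tt)
  ...   | inj₂ i , inj₂ j , inj₂ l , _ , _ , _ , x<y , y<z , _ =
    three-distinct (<⇒≢ x<y ∘ cong inj₂) (<⇒≢ (ℕ.<-trans x<y y<z) ∘ cong inj₂) (<⇒≢ y<z ∘ cong inj₂)

  record Edge (e f : Fin n) : Set where
    field
      ef   : adj G e f ≡ true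
      at-e : ∀ {x} → adj G e x ≡ true → x ≡ f
      at-f : ∀ {x} → adj G f x ≡ true → x ≡ e

  swap-edge : ∀ {e f} → Edge e f → Edge f e
  swap-edge E = record { ef = ≡.trans (adj-sym G _ _) ef ; at-e = at-f ; at-f = at-e }
    where open Edge E

  Off : Fin n → Fin n → Fin n → Set
  Off e f x = x ≢ e × x ≢ f

  -- `isolates≡` is k ≤ 1 in the form to be refuted: distinct labels cannot both belong to isolates.
  module _ {e f} (E : Edge e f) (f<e : λᵥ f < λᵥ e) {a b c d} (T : Sorted (Off e f) a b c d)
           (isolates≡ : ∀ (i j : Fin k) → i ≡ j) where
    open Edge E
    open Sorted T
    open Square isSquare

    data Kind : Fin n ⊎ Fin k → Set where
      is-e : Kind (inj₁ e)
      is-f : Kind (inj₁ f)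
      is-i : ∀ j → Kind (inj₂ j)

    kind : ∀ x → Outside T x → Kind x
    kind (inj₂ j) _ = is-i j
    kind (inj₁ v) o with v Fin.≟ e | v Fin.≟ f
    ... | yes refl | _        = is-e
    ... | _        | yes refl = is-f
    ... | no v≢e   | no v≢f   = ⊥-elim (o refl (v≢e , v≢f))

    same-isolate : ∀ {i j} → label (inj₂ i) < label (inj₂ j) → ⊥
    same-isolate {i} {j} l = <⇒≢ l (cong inj₂ (isolates≡ i j))

    f-not-b : adj G f b ≢ true
    f-not-b fb with at-b (≡.trans (adj-sym G _ _) fb)
    ... | inj₁ refl = b≢d (≡.trans (at-f ab) (sym (at-f (≡.trans (adj-sym G _ _) da))))
    ... | inj₂ refl = b≢d (≡.trans (at-f (≡.trans (adj-sym G _ _) bc)) (sym (at-f cd)))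

    b≢f : b ≢ f
    b≢f refl = a≢c (≡.trans (at-f (≡.trans (adj-sym G _ _) ab)) (sym (at-f bc)))

    inside-≤ : ∀ {v} → Off e f v → λᵥ v ≤ λᵥ a
    inside-≤ q with inside q
    ... | inj₁ refl               = ℕ.≤-refl
    ... | inj₂ (inj₁ refl)        = b≤a
    ... | inj₂ (inj₂ (inj₁ refl)) = ℕ.<⇒≤ c<a
    ... | inj₂ (inj₂ (inj₂ refl)) = d≤a

    d≢b+f : λᵥ d ≢ λᵥ b + λᵥ f
    d≢b+f s with sum⇒edge {inj₁ b} {inj₁ f} {inj₁ d} (b≢f ∘ inj₁-injective) s
    ... | _ , _ , refl , refl , bf = f-not-b (≡.trans (adj-sym G _ _) bf)

    -- The three labels outside C₄ are forced to be λ f < λ e < λ e + λ f, which joins f to C₄.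
    contradiction : ⊥
    contradiction with edge⇒sum ef | three-outside T
    ... | w , s | x , y , z , ox , oy , oz , x<y , y<z , y≡ , z≡ =
      cases w s (kind x ox) (kind y oy) (kind z oz) x<y y<z y≡ z≡
      where
      cases : ∀ {x y z} w → label w ≡ λᵥ e + λᵥ f → Kind x → Kind y → Kind z →
              label x < label y → label y < label z → label y ≡ λᵥ a + λᵥ b → label z ≡ λᵥ a + λᵥ d → ⊥
      -- If λ e + λ f labels a vertex of the graph, that vertex lies on the C₄, so λ e and λ f are
      -- at most λ a. Then y and z, both above λ a, are two isolates.
      cases {x} {y} {z} (inj₁ v) s kx ky kz x<y y<z y≡ _ = large ky kz y<z a<y (ℕ.<-trans a<y y<z)
        where
        a<y : λᵥ a < label y
        a<y = subst (λᵥ a <_) (sym y≡) (ℕ.m<m+n (λᵥ a) (λ-positive b))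
        v≤a : λᵥ e + λᵥ f ≤ λᵥ a
        v≤a = subst (_≤ λᵥ a) s (inside-≤
          ( (λ { refl → ℕ.<⇒≱ (ℕ.m<m+n (λᵥ e) (λ-positive f)) (ℕ.≤-reflexive (sym s)) })
          , (λ { refl → ℕ.<⇒≱ (ℕ.m<n+m (λᵥ f) (λ-positive e)) (ℕ.≤-reflexive (sym s)) })))
        e≤a : λᵥ e ≤ λᵥ a
        e≤a = ℕ.≤-trans (ℕ.m≤m+n (λᵥ e) (λᵥ f)) v≤a
        f≤a : λᵥ f ≤ λᵥ a
        f≤a = ℕ.≤-trans (ℕ.m≤n+m (λᵥ f) (λᵥ e)) v≤a
        large : ∀ {y z} → Kind y → Kind z → label y < label z → λᵥ a < label y → λᵥ a < label z → ⊥
        large is-e     _        _   a<y _   = ℕ.<⇒≱ a<y e≤a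
        large is-f     _        _   a<y _   = ℕ.<⇒≱ a<y f≤a
        large (is-i _) is-e     _   _   a<z = ℕ.<⇒≱ a<z e≤a
        large (is-i _) is-f     _   _   a<z = ℕ.<⇒≱ a<z f≤a
        large (is-i _) (is-i _) y<z _   _   = same-isolate y<z
      cases (inj₂ j) s kx (is-i i) (is-i l) x<y y<z _ _ = same-isolate y<z
      cases (inj₂ j) s kx (is-i i) is-e x<y y<z _ _ rewrite isolates≡ i j =
        ℕ.<⇒≱ y<z (subst (λᵥ e ≤_) (sym s) (ℕ.m≤m+n (λᵥ e) (λᵥ f)))
      cases (inj₂ j) s kx (is-i i) is-f x<y y<z _ _ rewrite isolates≡ i j =
        ℕ.<⇒≱ y<z (subst (λᵥ f ≤_) (sym s) (ℕ.m≤n+m (λᵥ f) (λᵥ e)))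
      cases (inj₂ j) s is-e is-f kz x<y _ _ _ = ℕ.<-asym x<y f<e
      cases (inj₂ j) s is-f is-f kz x<y _ _ _ = ℕ.<-irrefl refl x<y
      cases (inj₂ j) s (is-i i) is-f kz x<y _ _ _ rewrite isolates≡ i j =
        ℕ.<⇒≱ x<y (subst (λᵥ f ≤_) (sym s) (ℕ.m≤n+m (λᵥ f) (λᵥ e)))
      cases (inj₂ j) s kx is-e is-e _ y<z _ _ = ℕ.<-irrefl refl y<z
      cases (inj₂ j) s kx is-e is-f _ y<z _ _ = ℕ.<-asym y<z f<e
      -- The remaining order gives λ a + λ d = λ e + λ f with λ e = λ a + λ b, hence λ d = λ b + λ
      -- f, and b would be adjacent to f.
      cases (inj₂ j) s kx is-e (is-i i) _ _ y≡ z≡ rewrite isolates≡ i j =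
        d≢b+f (ℕ.+-cancelˡ-≡ (λᵥ a) _ _ (begin
          λᵥ a + λᵥ d          ≡⟨ z≡ ⟨
          label (inj₂ j)       ≡⟨ s ⟩
          λᵥ e + λᵥ f          ≡⟨ cong (_+ λᵥ f) y≡ ⟩
          λᵥ a + λᵥ b + λᵥ f   ≡⟨ ℕ.+-assoc (λᵥ a) _ _ ⟩
          λᵥ a + (λᵥ b + λᵥ f) ∎))
        where open ≡.≡-Reasoning

  edge-bound : ∀ {e f a b c d} → Edge e f → Square G (Off e f) a b c d → (∀ (i j : Fin k) → i ≡ j) → ⊥
  edge-bound {e} {f} E s i≡ with ℕ.<-cmp (λᵥ f) (λᵥ e)
  ... | tri≈ _ q _ = adj⇒≢ G (Edge.ef E) (sym (λ-injective q))
  ... | tri< l _ _ with sort s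
  ...   | _ , _ , _ , _ , T = contradiction E l T i≡
  edge-bound E s i≡ | tri> _ _ l
    with sort (record { Square s ; inside = λ { (p , q) → Square.inside s (q , p) } })
  ...   | _ , _ , _ , _ , T = contradiction (swap-edge E) l T i≡

  square+edge-bound : ∀ {e f a b c d} → Edge e f → Square G (Off e f) a b c d → 2 ≤ k
  square+edge-bound E s = by-size k (λ ne → two-distinct ne) (edge-bound E s)
    where
    by-size : ∀ k → (∀ {i j : Fin k} → i ≢ j → 2 ≤ k) → ((∀ (i j : Fin k) → i ≡ j) → ⊥) → 2 ≤ k
    by-size zero          _ ¬≡ = ⊥-elim (¬≡ λ ())
    by-size (suc zero)    _ ¬≡ = ⊥-elim (¬≡ λ { zero zero → refl })
    by-size (suc (suc k)) _ _  = s≤s (s≤s z≤n)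

SumLabels-≅ : ∀ {m n k} {G : Graph m} {H : Graph n} → G ≅ H → SumLabels G k → SumLabels H k
SumLabels-≅ {G = G} {H} (φ , φ-adj) S = record
  { label           = label ∘ pull
  ; label-injective = pull-injective _ _ ∘ label-injective
  ; label-positive  = label-positive ∘ pull
  ; edge⇒sum        = λ e → let z , s = edge⇒sum (≡.trans (adj-from _ _) e) in push z , ≡.trans (cong label (pull-push z)) s
  ; sum⇒edge        = λ {x} {y} ne s → sum-edge x y (sum⇒edge (ne ∘ pull-injective x y) s)
  }
  where
  open SumLabels S
  open Inverse φ using (to; from; strictlyInverseˡ; strictlyInverseʳ)
  pull = Sum.map₁ from
  push = Sum.map₁ to
  pull-push : ∀ z → pull (push z) ≡ z
  pull-push (inj₁ v) = cong inj₁ (strictlyInverseʳ v)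
  pull-push (inj₂ j) = refl
  push-pull : ∀ z → push (pull z) ≡ z
  push-pull (inj₁ v) = cong inj₁ (strictlyInverseˡ v)
  push-pull (inj₂ j) = refl
  pull-injective : ∀ x y → pull x ≡ pull y → x ≡ y
  pull-injective x y e = ≡.trans (sym (push-pull x)) (≡.trans (cong push e) (push-pull y))
  adj-from : ∀ i j → adj G (from i) (from j) ≡ adj H i j
  adj-from i j = ≡.trans (sym (φ-adj (from i) (from j))) (cong₂ (adj H) (strictlyInverseˡ i) (strictlyInverseˡ j))
  sum-edge : ∀ x y → (∃₂ λ a b → pull x ≡ inj₁ a × pull y ≡ inj₁ b × adj G a b ≡ true) →
             ∃₂ λ a b → x ≡ inj₁ a × y ≡ inj₁ b × adj H a b ≡ true
  sum-edge (inj₁ x) (inj₁ y) (_ , _ , refl , refl , e) = x , y , refl , refl , ≡.trans (sym (adj-from x y)) e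

-- The graphs C₄ and C₄ + P₂

neighbours? : ∀ {n} (G : Graph n) v y z → Dec (∀ x → adj G v x ≡ true → x ≡ y ⊎ x ≡ z)
neighbours? G v y z = Fin.all? λ x → (adj G v x Bool.≟ true) →-dec (x Fin.≟ y ⊎-dec x Fin.≟ z)

module _ {n} (G : Graph n) (D : List (Piece (Fin n))) where
  private
    module V = DecMembership (Fin._≟_ {n})
    module E = DecMembership (Prod.≡-dec (Fin._≟_ {n}) (Fin._≟_ {n}))

  spanning? : Dec (∀ v → v ∈ allVerts D)
  spanning? = Fin.all? (V._∈? allVerts D)

  distinct? : Dec (Unique (allVerts D))
  distinct? = allPairs? (λ a b → ¬? (a Fin.≟ b)) (allVerts D)

  adj⇒? : Dec (∀ u v → adj G u v ≡ true → Joined (allEdges D) u v)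
  adj⇒? = Fin.all? λ u → Fin.all? λ v →
    (adj G u v Bool.≟ true) →-dec ((u , v) E.∈? allEdges D ⊎-dec (v , u) E.∈? allEdges D)

  ⇒adj? : Dec (All (λ e → adj G (proj₁ e) (proj₂ e) ≡ true) (allEdges D))
  ⇒adj? = All.all? (λ e → adj G (proj₁ e) (proj₂ e) Bool.≟ true) (allEdges D)

decomposition-of : ∀ {n} (G : Graph n) D → All Valid D → Unique (allVerts D) → (∀ v → v ∈ allVerts D) →
                   (∀ u v → adj G u v ≡ true → Joined (allEdges D) u v) →
                   All (λ e → adj G (proj₁ e) (proj₂ e) ≡ true) (allEdges D) → Decomposition G
decomposition-of G D va u s to from = record
  { pieces = D ; valid = va ; distinct = u ; spanning = s ; adj⇒ = to _ _
  ; ⇒adj = [ All.lookup from , ≡.trans (adj-sym G _ _) ∘ All.lookup from ] }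

C4-pieces : List (Piece (Fin 4))
C4-pieces = cycle (0F ∷ 1F ∷ 2F ∷ 3F ∷ []) ∷ []

C4⊕P2-pieces : List (Piece (Fin 6))
C4⊕P2-pieces = path (4F ∷ 5F ∷ []) ∷ cycle (0F ∷ 1F ∷ 2F ∷ 3F ∷ []) ∷ []

C4-decomposition : Decomposition C4
C4-decomposition = decomposition-of C4 C4-pieces (cycle ∷ [])
  (from-yes (distinct? C4 C4-pieces)) (from-yes (spanning? C4 C4-pieces))
  (from-yes (adj⇒? C4 C4-pieces)) (from-yes (⇒adj? C4 C4-pieces))

C4⊕P2-decomposition : Decomposition (C4 ⊕ P2)
C4⊕P2-decomposition = decomposition-of (C4 ⊕ P2) C4⊕P2-pieces (path ∷ cycle ∷ [])
  (from-yes (distinct? (C4 ⊕ P2) C4⊕P2-pieces)) (from-yes (spanning? (C4 ⊕ P2) C4⊕P2-pieces))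
  (from-yes (adj⇒? (C4 ⊕ P2) C4⊕P2-pieces)) (from-yes (⇒adj? (C4 ⊕ P2) C4⊕P2-pieces))

C4-square : Square C4 (λ _ → ⊤) 0F 1F 2F 3F
C4-square = record
  { ab = refl ; bc = refl ; cd = refl ; da = refl
  ; at-a = from-yes (neighbours? C4 0F 3F 1F) _
  ; at-b = from-yes (neighbours? C4 1F 0F 2F) _
  ; at-c = from-yes (neighbours? C4 2F 1F 3F) _
  ; at-d = from-yes (neighbours? C4 3F 2F 0F) _
  ; a≢c = λ () ; b≢d = λ ()
  ; inside = λ {x} _ → from-yes (Fin.all? λ (x : Fin 4) → x Fin.≟ 0F ⊎-dec x Fin.≟ 1F ⊎-dec x Fin.≟ 2F ⊎-dec x Fin.≟ 3F) x
  }

C4⊕P2-square : Square (C4 ⊕ P2) (λ x → x ≢ 4F × x ≢ 5F) 0F 1F 2F 3F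
C4⊕P2-square = record
  { ab = refl ; bc = refl ; cd = refl ; da = refl
  ; at-a = from-yes (neighbours? (C4 ⊕ P2) 0F 3F 1F) _
  ; at-b = from-yes (neighbours? (C4 ⊕ P2) 1F 0F 2F) _
  ; at-c = from-yes (neighbours? (C4 ⊕ P2) 2F 1F 3F) _
  ; at-d = from-yes (neighbours? (C4 ⊕ P2) 3F 2F 0F) _
  ; a≢c = λ () ; b≢d = λ ()
  ; inside = λ {x} q → from-yes (Fin.all? λ (x : Fin 6) → (¬? (x Fin.≟ 4F) ×-dec ¬? (x Fin.≟ 5F)) →-dec
      (x Fin.≟ 0F ⊎-dec x Fin.≟ 1F ⊎-dec x Fin.≟ 2F ⊎-dec x Fin.≟ 3F)) x q
  }

module _ {k} (S : SumLabels (C4 ⊕ P2) k) where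
  open SquareBound S

  C4⊕P2-edge : Edge 4F 5F
  C4⊕P2-edge = record
    { ef   = refl
    ; at-e = λ {x} e → [ id , id ] (from-yes (neighbours? (C4 ⊕ P2) 4F 5F 5F) x e)
    ; at-f = λ {x} e → [ id , id ] (from-yes (neighbours? (C4 ⊕ P2) 5F 4F 4F) x e)
    }

  C4⊕P2-bound : 2 ≤ k
  C4⊕P2-bound = square+edge-bound C4⊕P2-edge C4⊕P2-square

exceptional-bound : ∀ {n} {G : Graph n} {d k} → MaxDegAtMost G 2 → IsMinDegree G d →
                    G ≅ C4 ⊎ G ≅ (C4 ⊕ P2) → SumLabels G k → suc d ≤ k
exceptional-bound Δ≤2 ((v , refl) , _) (inj₁ φ) S =
  ℕ.≤-trans (s≤s (Δ≤2 v)) (SquareBound.square-bound (SumLabels-≅ φ S) C4-square)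
exceptional-bound {G = G} {d} Δ≤2 (_ , d≤) (inj₂ (φ , φ-adj)) S =
  ℕ.≤-trans (s≤s (ℕ.≤-trans (d≤ (from 4F)) (one-neighbour⇒deg≤1 G (from 4F) {from 5F} only)))
    (C4⊕P2-bound (SumLabels-≅ (φ , φ-adj) S))
  where
  open Inverse φ using (to; from; strictlyInverseˡ; strictlyInverseʳ)
  only : ∀ {y} → adj G (from 4F) y ≡ true → y ≡ from 5F
  only {y} e = ≡.trans (sym (strictlyInverseʳ y)) (cong from ([ id , id ] (from-yes (neighbours? (C4 ⊕ P2) 4F 5F 5F) (to y)
    (≡.trans (cong (λ v → adj (C4 ⊕ P2) v (to y)) (sym (strictlyInverseˡ 4F))) (≡.trans (φ-adj (from 4F) y) e)))))

exceptional-labelling : ∀ {k cs ps} → Exceptional k cs ps → Labelling (normal k cs ps) (suc (isolate-count ps))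
exceptional-labelling C₄ = record
  { pieces = D ; isolates = I ; shapes = ↭-refl ; length≡ = refl
  ; system = from-yes (sumSystem? (allEdges D) (I ++ allVerts D)) }
  where
  -- The opposite edges 15 + 5 and 16 + 4 share the sum 20, so three isolates suffice for four
  -- edges.
  D = cycle (4 ∷ 15 ∷ 5 ∷ 16 ∷ []) ∷ []
  I = 19 ∷ 20 ∷ 21 ∷ []
exceptional-labelling C₄+P₂ = record
  { pieces = D ; isolates = I ; shapes = ↭-refl ; length≡ = refl
  ; system = from-yes (sumSystem? (allEdges D) (I ++ allVerts D)) }
  where
  -- The isolates 19 and 20 of the labelling of C₄ become the two vertices of P₂, whose edge sum 39
  -- is a new isolate.
  D = path (19 ∷ 20 ∷ []) ∷ cycle (4 ∷ 15 ∷ 5 ∷ 16 ∷ []) ∷ []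
  I = 21 ∷ 39 ∷ []

exceptional? : ∀ k cs ps → Dec (Exceptional k cs ps)
exceptional? 1 []      []             = yes C₄
exceptional? 1 []      (zero ∷ [])    = yes C₄+P₂
exceptional? 1 []      (suc _ ∷ [])   = no λ ()
exceptional? 1 []      (_ ∷ _ ∷ _)    = no λ ()
exceptional? 1 (_ ∷ _) _              = no λ ()
exceptional? 0 _ _                    = no λ ()
exceptional? (suc (suc _)) _ _        = no λ ()

-- Degrees of the vertices of the components

module Degrees {n} (G : Graph n) (1≤deg : NoIsolated G) (Δ≤2 : MaxDegAtMost G 2) (Δ : Decomposition G) where
  open Decomposition Δ

  local : ∀ {P a b} → P ∈ pieces → a ∈ verts P → adj G a b ≡ true → Joined (edges P) a b
  local {P} P∈ a∈ e with ∈-∃++ P∈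
  ... | ps , qs , eq = Joined-local P (ps ++ qs) (Unique-↭ (concatMap-↭ σ) distinct) a∈ (Joined-↭ (concatMap-↭ σ) (adj⇒ e))
    where
    σ : pieces ↭ P ∷ ps ++ qs
    σ = ↭-trans (↭-reflexive eq) (shift P ps qs)

  unique-in : ∀ {P} → P ∈ pieces → Unique (verts P)
  unique-in {P} P∈ with ∈-∃++ P∈
  ... | ps , qs , eq =
    Unique-++ˡ (verts P) (Unique-↭ (concatMap-↭ (↭-trans (↭-reflexive eq) (shift P ps qs))) distinct)

  within : ∀ {P a b} → P ∈ pieces → Joined (edges P) a b → adj G a b ≡ true
  within {P} P∈ j with ∈-∃++ P∈
  ... | ps , qs , eq =
    ⇒adj (Joined-↭ (↭-sym (concatMap-↭ (↭-trans (↭-reflexive eq) (shift P ps qs)))) (Joined-++⁺ˡ j))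

  proper : All Proper (map shape pieces)
  proper = All.map⁺ (All.tabulate piece-proper)
    where
    piece-proper : ∀ {P} → P ∈ pieces → Proper (shape P)
    piece-proper {cycle _} P∈ with All.lookup valid P∈
    ... | cycle = cycle _
    piece-proper {path (_ ∷ _ ∷ _)} _ = path _
    piece-proper {path []} P∈ with () ← All.lookup valid P∈
    piece-proper {path (x ∷ [])} P∈ with 1≤deg⇒neighbour G x (1≤deg x)
    ... | y , e with local P∈ (here refl) e
    ...   | inj₁ ()
    ...   | inj₂ ()

  path-end : ∀ {x y zs} → path (x ∷ y ∷ zs) ∈ pieces → deg G x ≤ 1
  path-end {x} {y} {zs} P∈ = one-neighbour⇒deg≤1 G x {y} (λ e → only (local P∈ (here refl) e))
    where
    uq : Unique (x ∷ y ∷ zs)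
    uq = unique-in P∈
    only : ∀ {w} → Joined (links (x ∷ y ∷ zs)) x w → w ≡ y
    only (inj₁ (here refl)) = refl
    only (inj₁ (there m))   = ⊥-elim (Unique-head uq (proj₁ (links-∈ (y ∷ zs) m)) refl)
    only (inj₂ (here refl)) = refl
    only (inj₂ (there m))   = ⊥-elim (Unique-head uq (proj₂ (links-∈ (y ∷ zs) m)) refl)

  cycle-vertex : ∀ {xs v} → cycle xs ∈ pieces → v ∈ xs → 2 ≤ deg G v
  cycle-vertex P∈ v∈ with cycle-two-neighbours (All.lookup valid P∈) (unique-in P∈) v∈
  ... | y , z , y≢z , j , k = two-neighbours⇒2≤deg G _ y≢z (within P∈ j) (within P∈ k)

  -- Without paths every vertex lies on a cycle and has degree two. With a path, an end of it has
  -- degree one, and no vertex has less.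
  min-degree : ∀ {k cs ps d} → map shape pieces ↭ normal k cs ps → IsMinDegree G d → isolate-count ps ≡ d
  min-degree {k} {cs} {[]} σ ((v , refl) , _) = ℕ.≤-antisym two≤ (Δ≤2 v)
    where
    normal-cycle : ∀ {m} cs k → path m ∉ map cycle₊ cs ++ replicate k square
    normal-cycle []       (suc k) (there m) = normal-cycle [] k m
    normal-cycle (c ∷ cs) k       (there m) = normal-cycle cs k m
    two≤ : 2 ≤ deg G v
    two≤ with piece-of pieces (spanning v)
    ... | path xs , _ , _ , τ = ⊥-elim (normal-cycle cs k (∈-resp-↭ σ (∈-map⁺ shape (∈-resp-↭ (↭-sym τ) (here refl)))))
    ... | cycle xs , _ , v∈ , τ = cycle-vertex (∈-resp-↭ (↭-sym τ) (here refl)) v∈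
  min-degree {k} {cs} {p ∷ ps} {d} σ ((v , e) , d≤) = ℕ.≤-antisym (subst (1 ≤_) e (1≤deg v)) d≤1
    where
    d≤1 : d ≤ 1
    d≤1 with ∈-map⁻ shape (∈-resp-↭ (↭-sym σ) (here refl))
    ... | path (x ∷ y ∷ zs) , P∈ , _ = ℕ.≤-trans (d≤ x) (path-end P∈)

exceptional⇒≅ : ∀ {n} {G : Graph n} (Δ : Decomposition G) {k cs ps} → Exceptional k cs ps →
                map shape (Decomposition.pieces Δ) ↭ normal k cs ps → G ≅ C4 ⊎ G ≅ (C4 ⊕ P2)
exceptional⇒≅ Δ C₄    σ = inj₁ (same-shape⇒≅ Δ C4-decomposition (↭-sym σ))
exceptional⇒≅ Δ C₄+P₂ σ = inj₂ (same-shape⇒≅ Δ C4⊕P2-decomposition (↭-sym σ))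

theorem1 : ∀ {n} (G : Graph n) → NoIsolated G → MaxDegAtMost G 2 →
    ∀ (d : ℕ) → IsMinDegree G d →
    ((G ≅ C4 ⊎ G ≅ (C4 ⊕ P2)) → IsSumNumber G (suc d)) ×
    (¬ (G ≅ C4 ⊎ G ≅ (C4 ⊕ P2)) → IsSumNumber G d)
theorem1 G 1≤deg Δ≤2 d min with decompose G (MaxDeg₂⇒NoThree G Δ≤2)
... | Δ with classify (Degrees.proper G 1≤deg Δ≤2 Δ)
...   | k , cs , ps , ns , σ with Degrees.min-degree G 1≤deg Δ≤2 Δ {k} {cs} {ps} σ min
...     | refl with exceptional? k cs ps
...       | yes ex =
  (λ ≅C4 → SumLabels⇒IsSumGraph (Labelling⇒SumLabels Δ (Labelling-↭ (↭-sym σ) (exceptional-labelling ex))) ,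
           λ m s → exceptional-bound Δ≤2 min ≅C4 (IsSumGraph⇒SumLabels s)) ,
  (λ ≇C4 → ⊥-elim (≇C4 (exceptional⇒≅ Δ ex σ)))
...       | no ¬ex =
  -- Uniqueness of the decomposition is avoided: an isomorphism with C₄ or C₄ + P₂ contradicts the
  -- lower bound, since `labels` uses only d isolates.
  (λ ≅C4 → ⊥-elim (ℕ.<-irrefl refl (exceptional-bound Δ≤2 min ≅C4 labels))) ,
  (λ _ → SumLabels⇒IsSumGraph labels ,
         λ m s → LowerBound.degree-bound (IsSumGraph⇒SumLabels s) Δ≤2 (proj₁ (proj₁ min)) (proj₂ min))
  where
  labels : SumLabels G (isolate-count ps)
  labels = Labelling⇒SumLabels Δ (Labelling-↭ (↭-sym σ) (labelling k ps ns ¬ex))
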